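{- Let $n = 2000k^2\log\log k$ and let $\sigma$ be a uniformly random permutation in $\mathcal{S}_n$. Then with high probability (i.e. with probability $1-o(1)$ as $k\to\infty$), $\sigma$ is $k$-universal.
   Context: $\mathcal{S}_n$ denotes the set of permutations of $[n]=\{1,\dots,n\}$. A permutation $\sigma\in\mathcal{S}_n$ contains a pattern $\pi\in\mathcal{S}_k$ if there are indices $1\le x_1<\dots<x_k\le n$ such that for all $1\le i,j\le k$, $\sigma(x_i)<\sigma(x_j)$ if and only if $\pi(i)<\pi(j)$. A permutation $\sigma$ is $k$-universal if it contains every $\pi\in\mathcal{S}_k$. Divisibility/integrality issues (e.g. $n$ being an integer) are ignored. $\log$ denotes the natural logarithm. -}

module Defs where

open import Data.Nat as ℕ using (ℕ; zero; suc; _!)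
open import Data.Integer using (ℤ; +_)
open import Data.Rational using (ℚ; _/_; 0ℚ; 1ℚ; _+_; _*_; _<_; _≤_)
open import Data.Fin as Fin using (Fin)
open import Data.Fin.Permutation using (Permutation′; _⟨$⟩ʳ_)
open import Data.List using (List; length)
open import Data.List.Relation.Unary.Any using (Any)
open import Data.Product using (Σ; ∃; _×_)
open import Function.Bundles using (_⇔_)
open import Relation.Binary.PropositionalEquality using (_≡_)
open import Relation.Nullary using (¬_)

ℕ→ℚ : ℕ → ℚ
ℕ→ℚ m = (+ m) / 1

Contains : {n k : ℕ} → Permutation′ n → Permutation′ k → Set
Contains {n} {k} σ π =
  Σ (Fin k → Fin n) λ x →
    (∀ i j → i Fin.< j → x i Fin.< x j) ×
    (∀ i j → ((σ ⟨$⟩ʳ x i) Fin.< (σ ⟨$⟩ʳ x j)) ⇔ ((π ⟨$⟩ʳ i) Fin.< (π ⟨$⟩ʳ j)))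

Universal : {n : ℕ} → (k : ℕ) → Permutation′ n → Set
Universal k σ = (π : Permutation′ k) → Contains σ π

-- Probability bound without reals:
-- P(σ not k-universal) ≤ ε   iff   the set of non-universal σ ∈ S_n has
-- size ≤ ε·n!, i.e. it is covered by a list (of maps Fin n → Fin n,
-- compared pointwise) of length ≤ ε·n!.
NonUniversalProbAtMost : (n k : ℕ) → ℚ → Set
NonUniversalProbAtMost n k ε =
  Σ (List (Fin n → Fin n)) λ L →
    (ℕ→ℚ (length L) ≤ ε * ℕ→ℚ (n !)) ×
    ((σ : Permutation′ n) → ¬ Universal k σ →
       Any (λ τ → ∀ i → σ ⟨$⟩ʳ i ≡ τ i) L)

expTerm : ℕ → ℚ → ℚ
expTerm zero    x = 1ℚ
expTerm (suc j) x = expTerm j x * x * ((+ 1) / suc j)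

expPartial : ℕ → ℚ → ℚ
expPartial zero    x = 0ℚ
expPartial (suc m) x = expPartial m x + expTerm m x

-- For rational x ≥ 0 the doubly-indexed partial sums
-- expPartial m₂ (expPartial m₁ x) increase to e^(e^x), hence
--   k ≤ e^(e^x)   iff   ∀ δ > 0, ∃ m₁ m₂, k < expPartial m₂ (expPartial m₁ x) + δ.
-- For k ≥ 1 this is equivalent to  log log k ≤ x.
LeExpExp : ℕ → ℚ → Set
LeExpExp k x =
  (δ : ℚ) → 0ℚ < δ →
    ∃ λ m₁ → ∃ λ m₂ → ℕ→ℚ k < expPartial m₂ (expPartial m₁ x) + δ

-- n / (2000 k²)  (k = 0 is irrelevant: k → ∞)
ratio : ℕ → ℕ → ℚ
ratio n zero    = 0ℚ
ratio n (suc k) = (+ n) / (2000 ℕ.* suc k ℕ.* suc k)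

-- 2000 k² log log k ≤ n
ThresholdLe : ℕ → ℕ → Set
ThresholdLe k n = LeExpExp k (ratio n k)

-- n = ⌈ 2000 k² log log k ⌉ : the least natural number ≥ 2000 k² log log k
IsN : ℕ → ℕ → Set
IsN k n = ThresholdLe k n × (∀ m → m ℕ.< n → ¬ ThresholdLe k m)

{-# OPTIONS --safe #-}

-- Colour the values of σ by M = 4k rows, each an interval, and cut the positions into M columns of
-- equal width.  A pattern π embeds as soon as one can choose increasing columns for its positions
-- and increasing rows for its values such that all k selected cells contain a point of σ.
--
-- Group the indices of π into blocks of b = 8m, m ≈ log₂ k, and give each block 2b consecutive lines,
-- within which it may be shifted by s ∈ {0, …, b - 1}; rows and columns are shifted independently.
-- A point of π then sees a b × b box of candidate cells.  A cell is empty with probability at most a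
-- large negative power of log k, so by a union bound over the sets of m cells, with high
-- probability every box has fewer than m empty cells.  Then the shifts exist by a local lemma: every
-- constraint excludes a proportion < m/b² of the pairs of shifts and every block meets at most b
-- constraints.  It is proved by counting partial solutions (Rosenfeld): each new block keeps at least
-- half of the expected number of extensions.
--
-- The emptiness probability is computed for independent uniform rows.  This is legitimate because some
-- colouring u of the values makes u ∘ σ at most as bad, for uniform σ, as an independent colouring, and
-- sorting u turns its colour classes into intervals.

module Submission where

open import Defs
open import Data.Nat
open import Data.Nat.Properties
open import Data.Nat.DivMod
open import Data.Nat.Divisibility using (n∣m*n)
open import Data.Nat.Tactic.RingSolver using (solve-∀)
import Data.Integer as ℤ
import Data.Integer.Properties as ℤ
open import Data.Rational as ℚ using (ℚ; 0ℚ; 1ℚ; mkℚ)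
import Data.Rational.Properties as ℚ
import Data.Rational.Unnormalised as ℚᵘ
import Data.Rational.Unnormalised.Properties as ℚᵘ
open import Data.Rational.Solver using (module +-*-Solver)
open +-*-Solver using (solve; _:*_; _:+_; _:=_)
open import Data.Fin as Fin using (Fin; zero; suc; toℕ; fromℕ<; punchIn; _↑ˡ_; _↑ʳ_)
open import Data.Fin.Properties as Fin using (all?; toℕ<n; toℕ-fromℕ<; toℕ-injective; fromℕ<-injective; ↑ˡ-injective; ↑ʳ-injective; ¬∀⟶∃¬)
open import Data.Fin.Permutation as Perm using (Permutation′; _⟨$⟩ʳ_; _⟨$⟩ˡ_; _∘ₚ_)
open import Data.Fin.Subset as Subset using (Subset; inside; ⊤; ∣_∣; _─_; _-_)
open import Data.Fin.Subset.Properties using (_∈?_; ∈⊤; nonempty?; p─q⊆p; x∈⁅x⁆; x∈p∧x≢y⇒x∈p-y; x∈p⇒∣p-x∣<∣p∣)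
open import Data.List using (List; []; _∷_; _++_; map; length; filter; allFin; concatMap; cartesianProduct)
open import Data.List.Properties using (length-map; length-++; length-tabulate; map-tabulate)
open import Data.List.Membership.Propositional using (_∈_; lose)
open import Data.List.Membership.Propositional.Properties using (∈-allFin; ∈-map⁺; ∈-map⁻; ∈-filter⁺; ∈-filter⁻; ∈-concatMap⁺; ∈-∃++; ∈-++⁻; ∈-++⁺ˡ; ∈-++⁺ʳ)
open import Data.List.Relation.Binary.Subset.Propositional using (_⊆_)
open import Data.List.Relation.Unary.Any using (Any; here; there)
open import Data.List.Relation.Unary.All as All using (All; []; _∷_)
open import Data.List.Relation.Unary.AllPairs using ([]; _∷_)
open import Data.List.Relation.Unary.Unique.Propositional using (Unique)
open import Data.List.Relation.Unary.Unique.Propositional.Properties using (allFin⁺; filter⁺; cartesianProduct⁺; map⁺)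
open import Data.Vec using (Vec; []; _∷_; lookup; _[_]≔_; here; there)
open import Data.Vec.Properties using (lookup∘update; lookup∘update′)
open import Data.Product using (∃; _×_; _,_; proj₁; proj₂)
open import Data.Sum using (_⊎_; inj₁; inj₂)
open import Function using (_∘_; id; mk⇔)
open import Relation.Binary using (tri<; tri≈; tri>)
open import Relation.Binary.PropositionalEquality
open import Relation.Nullary using (¬_; Dec; yes; no; contradiction; ¬?; _×-dec_; _⊎-dec_; _→-dec_)

-- Finite sums and counting

∑ : {A : Set} → List A → (A → ℕ) → ℕ
∑ []       f = 0
∑ (x ∷ xs) f = f x + ∑ xs f

𝟙 : {P : Set} → Dec P → ℕ
𝟙 (yes _) = 1
𝟙 (no  _) = 0

𝟙≤1 : {P : Set} (P? : Dec P) → 𝟙 P? ≤ 1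
𝟙≤1 (yes _) = ≤-refl
𝟙≤1 (no _)  = z≤n

𝟙-true : {P : Set} (P? : Dec P) → P → 𝟙 P? ≡ 1
𝟙-true (yes _) _ = refl
𝟙-true (no ¬p) p = contradiction p ¬p

𝟙≡0⇒¬ : {P : Set} (P? : Dec P) → 𝟙 P? ≡ 0 → ¬ P
𝟙≡0⇒¬ (no ¬p) _ = ¬p

𝟙-≤ : {P : Set} (P? : Dec P) {x : ℕ} → (P → 1 ≤ x) → 𝟙 P? ≤ x
𝟙-≤ (yes p) h = h p
𝟙-≤ (no _)  h = z≤n

𝟙-mono : {P Q : Set} (P? : Dec P) (Q? : Dec Q) → (P → Q) → 𝟙 P? ≤ 𝟙 Q?
𝟙-mono P? Q? h = 𝟙-≤ P? (λ p → ≤-reflexive (sym (𝟙-true Q? (h p))))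

∑-mono : {A : Set} (xs : List A) {f g : A → ℕ} → (∀ {x} → x ∈ xs → f x ≤ g x) → ∑ xs f ≤ ∑ xs g
∑-mono []       h = z≤n
∑-mono (x ∷ xs) h = +-mono-≤ (h (here refl)) (∑-mono xs (h ∘ there))

∑-cong : {A : Set} (xs : List A) {f g : A → ℕ} → (∀ x → f x ≡ g x) → ∑ xs f ≡ ∑ xs g
∑-cong []       h = refl
∑-cong (x ∷ xs) h = cong₂ _+_ (h x) (∑-cong xs h)

∑-distrib-+ : {A : Set} (xs : List A) (f g : A → ℕ) → ∑ xs (λ x → f x + g x) ≡ ∑ xs f + ∑ xs g
∑-distrib-+ []       f g = refl
∑-distrib-+ (x ∷ xs) f g rewrite ∑-distrib-+ xs f g = lemma (f x) (g x) (∑ xs f) (∑ xs g)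
  where
  lemma : ∀ a b c d → (a + b) + (c + d) ≡ (a + c) + (b + d)
  lemma = solve-∀

∑-*ˡ : {A : Set} (xs : List A) (c : ℕ) (f : A → ℕ) → ∑ xs (λ x → c * f x) ≡ c * ∑ xs f
∑-*ˡ []       c f = sym (*-zeroʳ c)
∑-*ˡ (x ∷ xs) c f rewrite ∑-*ˡ xs c f = sym (*-distribˡ-+ c (f x) (∑ xs f))

∑-*ʳ : {A : Set} (xs : List A) (f : A → ℕ) (c : ℕ) → ∑ xs (λ x → f x * c) ≡ ∑ xs f * c
∑-*ʳ []       f c = refl
∑-*ʳ (x ∷ xs) f c rewrite ∑-*ʳ xs f c = sym (*-distribʳ-+ c (f x) (∑ xs f))

∑-const : {A : Set} (xs : List A) (c : ℕ) → ∑ xs (λ _ → c) ≡ length xs * c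
∑-const []       c = refl
∑-const (x ∷ xs) c = cong (c +_) (∑-const xs c)

∑-bound : {A : Set} (xs : List A) {f : A → ℕ} {c : ℕ} → (∀ {x} → x ∈ xs → f x ≤ c) → ∑ xs f ≤ length xs * c
∑-bound xs {c = c} h = ≤-trans (∑-mono xs h) (≤-reflexive (∑-const xs c))

∑-swap : {A B : Set} (xs : List A) (ys : List B) (f : A → B → ℕ) →
         ∑ xs (λ x → ∑ ys (f x)) ≡ ∑ ys (λ y → ∑ xs (λ x → f x y))
∑-swap []       ys f = sym (trans (∑-const ys 0) (*-zeroʳ (length ys)))
∑-swap (x ∷ xs) ys f rewrite ∑-swap xs ys f = sym (∑-distrib-+ ys (f x) (λ y → ∑ xs (λ x → f x y)))

∑-++ : {A : Set} (xs ys : List A) (f : A → ℕ) → ∑ (xs ++ ys) f ≡ ∑ xs f + ∑ ys f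
∑-++ []       ys f = refl
∑-++ (x ∷ xs) ys f rewrite ∑-++ xs ys f = sym (+-assoc (f x) (∑ xs f) (∑ ys f))

∑-map : {A B : Set} (g : A → B) (xs : List A) (f : B → ℕ) → ∑ (map g xs) f ≡ ∑ xs (f ∘ g)
∑-map g []       f = refl
∑-map g (x ∷ xs) f = cong (f (g x) +_) (∑-map g xs f)

∑-concatMap : {A B : Set} (g : A → List B) (xs : List A) (f : B → ℕ) →
              ∑ (concatMap g xs) f ≡ ∑ xs (λ x → ∑ (g x) f)
∑-concatMap g []       f = refl
∑-concatMap g (x ∷ xs) f rewrite ∑-++ (g x) (concatMap g xs) f = cong (∑ (g x) f +_) (∑-concatMap g xs f)

∑-cartesianProduct : {A B : Set} (xs : List A) (ys : List B) (f : A × B → ℕ) →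
                     ∑ (cartesianProduct xs ys) f ≡ ∑ xs (λ x → ∑ ys (λ y → f (x , y)))
∑-cartesianProduct []       ys f = refl
∑-cartesianProduct (x ∷ xs) ys f =
  trans (∑-++ (map (_,_ x) ys) (cartesianProduct xs ys) f)
        (cong₂ _+_ (∑-map (_,_ x) ys f) (∑-cartesianProduct xs ys f))

f≤∑ : {A : Set} {xs : List A} (f : A → ℕ) {x : A} → x ∈ xs → f x ≤ ∑ xs f
f≤∑ f (here refl) = m≤m+n _ _
f≤∑ f (there {y} p) = ≤-trans (f≤∑ f p) (m≤n+m _ (f y))

∑≡0⇒≡0 : {A : Set} {xs : List A} {f : A → ℕ} → ∑ xs f ≡ 0 → ∀ {x} → x ∈ xs → f x ≡ 0
∑≡0⇒≡0 {f = f} eq x∈xs = n≤0⇒n≡0 (≤-trans (f≤∑ f x∈xs) (≤-reflexive eq))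

∑-positive : {A : Set} (xs : List A) (f : A → ℕ) → 1 ≤ ∑ xs f → ∃ λ x → 1 ≤ f x
∑-positive (x ∷ xs) f h with f x in eq
... | suc _ = x , ≤-trans (s≤s z≤n) (≤-reflexive (sym eq))
... | zero  = ∑-positive xs f h

∑-average : {A : Set} (x : A) (xs : List A) (f : A → ℕ) (c : ℕ) →
            ∑ (x ∷ xs) f ≤ length (x ∷ xs) * c → ∃ λ y → f y ≤ c
∑-average x xs f c h with f x ≤? c
∑-average x xs       f c h | yes p = x , p
∑-average x []       f c h | no ¬p = contradiction (+-cancelʳ-≤ 0 _ _ h) ¬p
∑-average x (y ∷ ys) f c h | no ¬p = ∑-average y ys f c
  (+-cancelˡ-≤ c _ _ (≤-trans (+-monoˡ-≤ _ (<⇒≤ (≰⇒> ¬p))) h))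

length-filter-∑ : {A : Set} {P : A → Set} (P? : ∀ x → Dec (P x)) (xs : List A) →
                  length (filter P? xs) ≡ ∑ xs (λ x → 𝟙 (P? x))
length-filter-∑ P? []       = refl
length-filter-∑ P? (x ∷ xs) with P? x
... | yes _ = cong suc (length-filter-∑ P? xs)
... | no  _ = length-filter-∑ P? xs

-- One occurrence of the head is cut out of `ys`; by uniqueness the tail avoids the head, so it
-- still lies in what remains.
∑-⊆ : {A : Set} {xs ys : List A} (f : A → ℕ) → Unique xs → xs ⊆ ys → ∑ xs f ≤ ∑ ys f
∑-⊆ {xs = []}     f _ _ = z≤n
∑-⊆ {xs = x ∷ xs} {ys} f (x≢ ∷ u) xs⊆ with ∈-∃++ (xs⊆ (here refl))
... | ps , qs , refl = begin
  f x + ∑ xs f               ≤⟨ +-monoʳ-≤ (f x) (∑-⊆ f u rest) ⟩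
  f x + ∑ (ps ++ qs) f       ≡⟨ cong (f x +_) (∑-++ ps qs f) ⟩
  f x + (∑ ps f + ∑ qs f)    ≡⟨ lemma (f x) (∑ ps f) (∑ qs f) ⟩
  ∑ ps f + (f x + ∑ qs f)    ≡⟨ ∑-++ ps (x ∷ qs) f ⟨
  ∑ (ps ++ x ∷ qs) f         ∎
  where
  open ≤-Reasoning
  lemma : ∀ a b c → a + (b + c) ≡ b + (a + c)
  lemma = solve-∀
  rest : xs ⊆ ps ++ qs
  rest y∈xs with ∈-++⁻ ps (xs⊆ (there y∈xs))
  ... | inj₁ p           = ∈-++⁺ˡ p
  ... | inj₂ (here refl) = contradiction refl (All.lookup x≢ y∈xs)
  ... | inj₂ (there q)   = ∈-++⁺ʳ ps q

length-⊆ : {A : Set} {xs ys : List A} → Unique xs → xs ⊆ ys → length xs ≤ length ys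
length-⊆ {xs = xs} {ys} u xs⊆ys = begin
  length xs         ≡⟨ *-identityʳ _ ⟨
  length xs * 1     ≡⟨ ∑-const xs 1 ⟨
  ∑ xs (λ _ → 1)    ≤⟨ ∑-⊆ _ u xs⊆ys ⟩
  ∑ ys (λ _ → 1)    ≡⟨ ∑-const ys 1 ⟩
  length ys * 1     ≡⟨ *-identityʳ _ ⟩
  length ys         ∎
  where open ≤-Reasoning

length-allFin : ∀ n → length (allFin n) ≡ n
length-allFin n = length-tabulate id

map-unique : {A B : Set} {P : A → Set} (g : A → B) → (∀ {x y} → P x → P y → g x ≡ g y → x ≡ y) →
             {xs : List A} → All P xs → Unique xs → Unique (map g xs)
map-unique g inj []         []        = []
map-unique g inj {x ∷ xs} (px ∷ pxs) (x≢ ∷ u) = go pxs x≢ ∷ map-unique g inj pxs u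
  where
  go : ∀ {ys} → All _ ys → All (x ≢_) ys → All (g x ≢_) (map g ys)
  go []         []       = []
  go (py ∷ pys) (n ∷ ns) = (λ e → n (inj px py e)) ∷ go pys ns

count≤ : ∀ {k b} {P : Fin k → Set} (P? : ∀ j → Dec (P j)) (g : Fin k → Fin b) →
         (∀ {i j} → P i → P j → g i ≡ g j → i ≡ j) → ∑ (allFin k) (λ j → 𝟙 (P? j)) ≤ b
count≤ {k} {b} P? g inj = begin
  ∑ (allFin k) (λ j → 𝟙 (P? j))       ≡⟨ length-filter-∑ P? (allFin k) ⟨
  length sel                          ≡⟨ length-map g sel ⟨
  length (map g sel)                  ≤⟨ length-⊆ (map-unique g inj (All.tabulate (λ i∈ → proj₂ (∈-filter⁻ P? {xs = allFin k} i∈))) (filter⁺ P? (allFin⁺ k))) (λ {y} _ → ∈-allFin y) ⟩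
  length (allFin b)                   ≡⟨ length-allFin b ⟩
  b                                   ∎
  where
  open ≤-Reasoning
  sel = filter P? (allFin k)

≤count : ∀ {n w} {P : Fin n → Set} (P? : ∀ j → Dec (P j)) (g : Fin w → Fin n) →
         (∀ {x y} → g x ≡ g y → x ≡ y) → (∀ y → P (g y)) → w ≤ ∑ (allFin n) (λ j → 𝟙 (P? j))
≤count {n} {w} P? g inj Pg = begin
  w                                   ≡⟨ length-allFin w ⟨
  length (allFin w)                   ≡⟨ *-identityʳ _ ⟨
  length (allFin w) * 1               ≡⟨ ∑-const (allFin w) 1 ⟨
  ∑ (allFin w) (λ _ → 1)              ≡⟨ ∑-cong (allFin w) (λ y → sym (𝟙-true (P? (g y)) (Pg y))) ⟩
  ∑ (allFin w) (λ y → 𝟙 (P? (g y)))   ≡⟨ ∑-map g (allFin w) _ ⟨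
  ∑ (map g (allFin w)) (λ j → 𝟙 (P? j)) ≤⟨ ∑-⊆ _ (map-unique {P = λ _ → Fin w} g (λ _ _ → inj) (All.tabulate (λ {x} _ → x)) (allFin⁺ w)) (λ {y} _ → ∈-allFin y) ⟩
  ∑ (allFin n) (λ j → 𝟙 (P? j))       ∎
  where open ≤-Reasoning

-- The local lemma

vecs : (M n : ℕ) → List (Vec (Fin M) n)
vecs M zero    = [] ∷ []
vecs M (suc n) = concatMap (λ a → map (a ∷_) (vecs M n)) (allFin M)

∑-vecs : ∀ {M n} (F : Vec (Fin M) (suc n) → ℕ) →
         ∑ (vecs M (suc n)) F ≡ ∑ (allFin M) (λ a → ∑ (vecs M n) (λ v → F (a ∷ v)))
∑-vecs {M} {n} F = trans (∑-concatMap _ (allFin M) F) (∑-cong (allFin M) (λ a → ∑-map (a ∷_) (vecs M n) F))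

length-vecs : ∀ M n → length (vecs M n) ≡ M ^ n
length-vecs M zero    = refl
length-vecs M (suc n) = begin
  length (vecs M (suc n))                    ≡⟨ *-identityʳ _ ⟨
  length (vecs M (suc n)) * 1                ≡⟨ ∑-const (vecs M (suc n)) 1 ⟨
  ∑ (vecs M (suc n)) (λ _ → 1)               ≡⟨ ∑-vecs {M} {n} (λ _ → 1) ⟩
  ∑ (allFin M) (λ _ → ∑ (vecs M n) (λ _ → 1)) ≡⟨ ∑-const (allFin M) _ ⟩
  length (allFin M) * ∑ (vecs M n) (λ _ → 1) ≡⟨ cong₂ _*_ (length-allFin M) (∑-const (vecs M n) 1) ⟩
  M * (length (vecs M n) * 1)                ≡⟨ cong (M *_) (trans (*-identityʳ _) (length-vecs M n)) ⟩
  M ^ suc n                                  ∎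
  where open ≡-Reasoning

-- Redrawing coordinate `i` preserves the uniform distribution: each vector arises as `v [ i ]≔ a`
-- from exactly `M` pairs `(v , a)`.
∑-resample : ∀ {M n} (i : Fin n) (G : Vec (Fin M) n → ℕ) →
             M * ∑ (vecs M n) G ≡ ∑ (vecs M n) (λ v → ∑ (allFin M) (λ a → G (v [ i ]≔ a)))
∑-resample {M} {suc n} zero G = begin
  M * ∑ (vecs M (suc n)) G
    ≡⟨ cong₂ _*_ (sym (length-allFin M)) (trans (∑-vecs G) (∑-swap (allFin M) (vecs M n) (λ a v → G (a ∷ v)))) ⟩
  length (allFin M) * ∑ (vecs M n) (λ v → ∑ (allFin M) (λ a → G (a ∷ v)))
    ≡⟨ ∑-const (allFin M) _ ⟨
  ∑ (allFin M) (λ _ → ∑ (vecs M n) (λ v → ∑ (allFin M) (λ a → G (a ∷ v))))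
    ≡⟨ ∑-vecs {M} {n} _ ⟨
  ∑ (vecs M (suc n)) (λ v → ∑ (allFin M) (λ a → G (v [ zero ]≔ a)))
    ∎
  where open ≡-Reasoning
∑-resample {M} {suc n} (suc i) G = begin
  M * ∑ (vecs M (suc n)) G
    ≡⟨ cong (M *_) (∑-vecs G) ⟩
  M * ∑ (allFin M) (λ c → ∑ (vecs M n) (λ v → G (c ∷ v)))
    ≡⟨ ∑-*ˡ (allFin M) M _ ⟨
  ∑ (allFin M) (λ c → M * ∑ (vecs M n) (λ v → G (c ∷ v)))
    ≡⟨ ∑-cong (allFin M) (λ c → ∑-resample i (λ v → G (c ∷ v))) ⟩
  ∑ (allFin M) (λ c → ∑ (vecs M n) (λ v → ∑ (allFin M) (λ a → G (c ∷ (v [ i ]≔ a)))))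
    ≡⟨ ∑-vecs {M} {n} _ ⟨
  ∑ (vecs M (suc n)) (λ v → ∑ (allFin M) (λ a → G (v [ suc i ]≔ a)))
    ∎
  where open ≡-Reasoning

x∈p─q⇒x∉q : ∀ {n} (p q : Subset n) {x} → x Subset.∈ p ─ q → x Subset.∉ q
x∈p─q⇒x∉q (_ ∷ p) (_ ∷ q) {suc x} (there x∈) (there x∈q) = x∈p─q⇒x∉q p q x∈ x∈q
x∈p─q⇒x∉q (_ ∷ p) (inside ∷ q) {zero} () here

x∉p-x : ∀ {n} (p : Subset n) x → x Subset.∉ p - x
x∉p-x p x x∈ = x∈p─q⇒x∉q p _ x∈ (x∈⁅x⁆ x)

x∈p-y⇒x∈p : ∀ {n} (p : Subset n) y {x} → x Subset.∈ p - y → x Subset.∈ p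
x∈p-y⇒x∈p p y = p─q⊆p p _

-- A graph with vertices `Fin V` and an edge from `p j` to `q j` for each constraint `j`; wanted is
-- a value in `Fin T` for each vertex such that no edge is bad. In the application the vertices are
-- blocks and the values their shifts.
module LocalLemma {V T K : ℕ} (p q : Fin K → Fin V)
                  (Bad : Fin K → Fin T → Fin T → Set) (Bad? : ∀ j s t → Dec (Bad j s t)) where

  Valid : Subset V → Vec (Fin T) V → Set
  Valid W f = ∀ j → p j Subset.∈ W → q j Subset.∈ W → ¬ Bad j (lookup f (p j)) (lookup f (q j))

  valid? : ∀ W f → Dec (Valid W f)
  valid? W f = all? (λ j → (p j ∈? W) →-dec ((q j ∈? W) →-dec ¬? (Bad? j _ _)))

  -- Assignments are total, with free values outside `W`. So this is `T ^ (V - ∣ W ∣)` times the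
  -- number of partial solutions on `W`, and counts for different `W` are proportions of the same
  -- `T ^ V`.
  #valid : Subset V → ℕ
  #valid W = ∑ (vecs T V) (λ f → 𝟙 (valid? W f))

  Valid-update : ∀ {W u} f s → u Subset.∉ W → Valid W (f [ u ]≔ s) → Valid W f
  Valid-update {W} {u} f s u∉W valid j p∈W q∈W =
    subst₂ (λ a b → ¬ Bad j a b) (same p∈W) (same q∈W) (valid j p∈W q∈W)
    where
    same : ∀ {x} → x Subset.∈ W → lookup (f [ u ]≔ s) x ≡ lookup f x
    same x∈W = lookup∘update′ (λ { refl → u∉W x∈W }) f s

  Violates : Subset V → Fin K → Vec (Fin T) V → Set
  Violates W j f = Valid W f × Bad j (lookup f (p j)) (lookup f (q j))

  violates? : ∀ W j f → Dec (Violates W j f)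
  violates? W j f = valid? W f ×-dec Bad? j _ _

  #bad : Fin K → ℕ
  #bad j = ∑ (allFin T) (λ s → ∑ (allFin T) (λ t → 𝟙 (Bad? j s t)))

  -- Off W the endpoints of j are free, so violating j is independent of being valid on W.
  #violates-≤ : ∀ {W} j → p j ≢ q j → p j Subset.∉ W → q j Subset.∉ W →
                T * (T * ∑ (vecs T V) (λ f → 𝟙 (violates? W j f))) ≤ #valid W * #bad j
  #violates-≤ {W} j p≢q p∉W q∉W = begin
    T * (T * ∑ (vecs T V) G)
      ≡⟨ cong (T *_) (∑-resample (q j) G) ⟩
    T * ∑ (vecs T V) (λ f → ∑ (allFin T) (λ t → G (f [ q j ]≔ t)))
      ≡⟨ ∑-resample (p j) _ ⟩
    ∑ (vecs T V) (λ f → ∑ (allFin T) (λ s → ∑ (allFin T) (λ t → G ((f [ p j ]≔ s) [ q j ]≔ t))))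
      ≤⟨ ∑-mono (vecs T V) (λ {f} _ → ∑-mono (allFin T) (λ {s} _ → ∑-mono (allFin T) (λ {t} _ → pointwise f s t))) ⟩
    ∑ (vecs T V) (λ f → ∑ (allFin T) (λ s → ∑ (allFin T) (λ t → 𝟙 (valid? W f) * 𝟙 (Bad? j s t))))
      ≡⟨ ∑-cong (vecs T V) (λ f → trans
           (∑-cong (allFin T) (λ s → ∑-*ˡ (allFin T) (𝟙 (valid? W f)) (λ t → 𝟙 (Bad? j s t))))
           (∑-*ˡ (allFin T) (𝟙 (valid? W f)) (λ s → ∑ (allFin T) (λ t → 𝟙 (Bad? j s t))))) ⟩
    ∑ (vecs T V) (λ f → 𝟙 (valid? W f) * #bad j)
      ≡⟨ ∑-*ʳ (vecs T V) _ _ ⟩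
    #valid W * #bad j
      ∎
    where
    open ≤-Reasoning
    G : Vec (Fin T) V → ℕ
    G f = 𝟙 (violates? W j f)
    pointwise : ∀ f s t → G ((f [ p j ]≔ s) [ q j ]≔ t) ≤ 𝟙 (valid? W f) * 𝟙 (Bad? j s t)
    pointwise f s t = 𝟙-≤ (violates? W j ((f [ p j ]≔ s) [ q j ]≔ t)) λ (valid , bad) → ≤-reflexive (sym (cong₂ _*_
      (𝟙-true (valid? W f) (Valid-update f s p∉W (Valid-update (f [ p j ]≔ s) t q∉W valid)))
      (𝟙-true (Bad? j s t) (subst₂ (Bad j)
        (trans (lookup∘update′ p≢q (f [ p j ]≔ s) t) (lookup∘update (p j) f s))
        (lookup∘update (q j) (f [ p j ]≔ s) t) bad))))

  module _ {D c : ℕ} (p≢q : ∀ j → p j ≢ q j) (#bad≤c : ∀ j → #bad j ≤ c)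
           (degree≤D : ∀ v → ∑ (allFin K) (λ j → 𝟙 ((p j Fin.≟ v) ⊎-dec (q j Fin.≟ v))) ≤ D)
           (4Dc≤TT : 4 * (D * c) ≤ T * T) (T>0 : 1 ≤ T) where

    Touches : Subset V → Fin V → Fin K → Set
    Touches W v j = p j Subset.∈ W × q j Subset.∈ W × (p j ≡ v ⊎ q j ≡ v)

    NewlyViolates : Subset V → Fin V → Fin K → Vec (Fin T) V → Set
    NewlyViolates W v j f = Touches W v j × Violates (W - v) j f

    newlyViolates? : ∀ W v j f → Dec (NewlyViolates W v j f)
    newlyViolates? W v j f =
      ((p j ∈? W) ×-dec ((q j ∈? W) ×-dec ((p j Fin.≟ v) ⊎-dec (q j Fin.≟ v)))) ×-dec violates? (W - v) j f

    -- What is valid on `W - v` fails on `W` only through a constraint inside `W` with `v` as an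
    -- endpoint; these are summed over.
    #valid-remove : ∀ W v → #valid (W - v) ≤
      #valid W + ∑ (allFin K) (λ j → ∑ (vecs T V) (λ f → 𝟙 (newlyViolates? W v j f)))
    #valid-remove W v = begin
      #valid (W - v)
        ≤⟨ ∑-mono (vecs T V) (λ {f} _ → pointwise f) ⟩
      ∑ (vecs T V) (λ f → 𝟙 (valid? W f) + ∑ (allFin K) (λ j → 𝟙 (newlyViolates? W v j f)))
        ≡⟨ ∑-distrib-+ (vecs T V) _ _ ⟩
      #valid W + ∑ (vecs T V) (λ f → ∑ (allFin K) (λ j → 𝟙 (newlyViolates? W v j f)))
        ≡⟨ cong (#valid W +_) (∑-swap (vecs T V) (allFin K) _) ⟩
      #valid W + ∑ (allFin K) (λ j → ∑ (vecs T V) (λ f → 𝟙 (newlyViolates? W v j f)))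
        ∎
      where
      open ≤-Reasoning
      pointwise : ∀ f → 𝟙 (valid? (W - v) f) ≤ 𝟙 (valid? W f) + ∑ (allFin K) (λ j → 𝟙 (newlyViolates? W v j f))
      pointwise f with valid? W f
      ... | yes _  = ≤-trans (𝟙≤1 (valid? (W - v) f)) (m≤m+n 1 _)
      ... | no ¬valid = 𝟙-≤ (valid? (W - v) f) go
        where
        go : Valid (W - v) f → 1 ≤ ∑ (allFin K) (λ j → 𝟙 (newlyViolates? W v j f))
        go valid with ∑ (allFin K) (λ j → 𝟙 (newlyViolates? W v j f)) in eq
        ... | suc _ = s≤s z≤n
        ... | zero  = contradiction (λ j p∈ q∈ bad → 𝟙≡0⇒¬ (newlyViolates? W v j f) (∑≡0⇒≡0 eq (∈-allFin j))
                        ((p∈ , q∈ , touches j p∈ q∈ bad) , valid , bad)) ¬valid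
          where
          touches : ∀ j → p j Subset.∈ W → q j Subset.∈ W → Bad j (lookup f (p j)) (lookup f (q j)) → p j ≡ v ⊎ q j ≡ v
          touches j p∈ q∈ bad with p j Fin.≟ v | q j Fin.≟ v
          ... | yes e | _     = inj₁ e
          ... | no _  | yes e = inj₂ e
          ... | no p≢v | no q≢v = contradiction bad (valid j (x∈p∧x≢y⇒x∈p-y p∈ p≢v) (x∈p∧x≢y⇒x∈p-y q∈ q≢v))

    -- Validity on `W - v` may depend on the value at the other endpoint `u` of `j`. Dropping `u` as
    -- well frees both endpoints, so `#violates-≤` applies on `W - v - u`, and `halving` bounds the
    -- price of this by a factor 2.
    #newlyViolates-≤ : ∀ W v → (∀ u → u Subset.∈ W - v → #valid (W - v - u) ≤ 2 * #valid (W - v)) → ∀ j →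
      T * (T * ∑ (vecs T V) (λ f → 𝟙 (newlyViolates? W v j f))) ≤
      𝟙 ((p j Fin.≟ v) ⊎-dec (q j Fin.≟ v)) * (2 * #valid (W - v) * c)
    #newlyViolates-≤ W v halving j with (p j ∈? W) ×-dec ((q j ∈? W) ×-dec ((p j Fin.≟ v) ⊎-dec (q j Fin.≟ v)))
    ... | no ¬touches = ≤-trans (≤-reflexive vanish) z≤n
      where
      vanish : T * (T * ∑ (vecs T V) (λ _ → 0)) ≡ 0
      vanish rewrite ∑-const (vecs T V) 0 | *-zeroʳ (length (vecs T V)) | *-zeroʳ T = *-zeroʳ T
    ... | yes (p∈ , q∈ , touches) = begin
      T * (T * ∑ (vecs T V) (λ f → 𝟙 (yes (p∈ , q∈ , touches) ×-dec violates? (W - v) j f)))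
        ≤⟨ *-monoʳ-≤ T (*-monoʳ-≤ T (∑-mono (vecs T V) (λ {f} _ →
             𝟙-mono (yes _ ×-dec violates? (W - v) j f) (violates? (W - v - u) j f)
               λ (_ , valid , bad) → (λ i p∈′ q∈′ → valid i (x∈p-y⇒x∈p _ u p∈′) (x∈p-y⇒x∈p _ u q∈′)) , bad))) ⟩
      T * (T * ∑ (vecs T V) (λ f → 𝟙 (violates? (W - v - u) j f)))
        ≤⟨ #violates-≤ j (p≢q j) (proj₁ fresh) (proj₂ fresh) ⟩
      #valid (W - v - u) * #bad j
        ≤⟨ *-mono-≤ (halving u u∈) (#bad≤c j) ⟩
      2 * #valid (W - v) * c
        ≡⟨ *-identityˡ _ ⟨
      1 * (2 * #valid (W - v) * c)
        ≡⟨ cong (_* (2 * #valid (W - v) * c)) (𝟙-true ((p j Fin.≟ v) ⊎-dec (q j Fin.≟ v)) touches) ⟨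
      𝟙 ((p j Fin.≟ v) ⊎-dec (q j Fin.≟ v)) * (2 * #valid (W - v) * c)
        ∎
      where
      open ≤-Reasoning
      other : p j ≡ v ⊎ q j ≡ v → ∃ λ u → u Subset.∈ W - v × p j Subset.∉ W - v - u × q j Subset.∉ W - v - u
      other (inj₁ refl) = q j , x∈p∧x≢y⇒x∈p-y q∈ (p≢q j ∘ sym) ,
                        (λ e → x∉p-x W (p j) (x∈p-y⇒x∈p _ (q j) e)) , x∉p-x _ (q j)
      other (inj₂ refl) = p j , x∈p∧x≢y⇒x∈p-y p∈ (p≢q j) ,
                        x∉p-x _ (p j) , (λ e → x∉p-x W (q j) (x∈p-y⇒x∈p _ (p j) e))
      u = proj₁ (other touches)
      u∈ = proj₁ (proj₂ (other touches))
      fresh = proj₂ (proj₂ (other touches))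

    -- Rosenfeld's induction: by the bound for the smaller set `W - v`, each of the at most `D`
    -- constraints at `v` spoils a proportion at most `2 * c / (T * T)` of the assignments valid on
    -- `W - v`, together at most one half since `4 * (D * c) ≤ T * T`.
    #valid-halving : ∀ s W → ∣ W ∣ ≤ s → ∀ v → v Subset.∈ W → #valid (W - v) ≤ 2 * #valid W
    #valid-halving zero    W ∣W∣≤0 v v∈W = contradiction (<-≤-trans (x∈p⇒∣p-x∣<∣p∣ v∈W) ∣W∣≤0) (λ ())
    #valid-halving (suc s) W ∣W∣≤s v v∈W =
      -- `T * T * A` is added on both sides; on the right it bounds the doubled loss
      -- `4 * (D * c) * A`.
      *-cancelˡ-≤ (T * T) {{m*n≢0 T T {{>-nonZero T>0}} {{>-nonZero T>0}}}} (+-cancelʳ-≤ (T * T * A) _ _ (begin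
        T * T * A + T * T * A                   ≡⟨ double (T * T * A) ⟩
        2 * (T * T * A)                         ≤⟨ *-monoʳ-≤ 2 step ⟩
        2 * (T * T * #valid W + D * (2 * A * c)) ≡⟨ rearrange (T * T) (#valid W) D A c ⟩
        T * T * (2 * #valid W) + 4 * (D * c) * A ≤⟨ +-monoʳ-≤ (T * T * (2 * #valid W)) (*-monoˡ-≤ A 4Dc≤TT) ⟩
        T * T * (2 * #valid W) + T * T * A      ∎))
      where
      open ≤-Reasoning
      A = #valid (W - v)
      X : Fin K → ℕ
      X j = ∑ (vecs T V) (λ f → 𝟙 (newlyViolates? W v j f))
      double : ∀ x → x + x ≡ 2 * x
      double = solve-∀
      rearrange : ∀ t y d a e → 2 * (t * y + d * (2 * a * e)) ≡ t * (2 * y) + 4 * (d * e) * a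
      rearrange = solve-∀
      IH : ∀ u → u Subset.∈ W - v → #valid (W - v - u) ≤ 2 * #valid (W - v)
      IH = #valid-halving s (W - v) (s≤s⁻¹ (<-≤-trans (x∈p⇒∣p-x∣<∣p∣ v∈W) ∣W∣≤s))
      step : T * T * A ≤ T * T * #valid W + D * (2 * A * c)
      step = begin
        T * T * A                                          ≤⟨ *-monoʳ-≤ (T * T) (#valid-remove W v) ⟩
        T * T * (#valid W + ∑ (allFin K) X)                ≡⟨ *-distribˡ-+ (T * T) _ _ ⟩
        T * T * #valid W + T * T * ∑ (allFin K) X          ≡⟨ cong (T * T * #valid W +_) (∑-*ˡ (allFin K) (T * T) X) ⟨
        T * T * #valid W + ∑ (allFin K) (λ j → T * T * X j)
          ≤⟨ +-monoʳ-≤ (T * T * #valid W) (∑-mono (allFin K) (λ {j} _ →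
               ≤-trans (≤-reflexive (*-assoc T T (X j))) (#newlyViolates-≤ W v IH j))) ⟩
        T * T * #valid W + ∑ (allFin K) (λ j → 𝟙 ((p j Fin.≟ v) ⊎-dec (q j Fin.≟ v)) * (2 * A * c))
          ≡⟨ cong (T * T * #valid W +_) (∑-*ʳ (allFin K) _ _) ⟩
        T * T * #valid W + ∑ (allFin K) (λ j → 𝟙 ((p j Fin.≟ v) ⊎-dec (q j Fin.≟ v))) * (2 * A * c)
          ≤⟨ +-monoʳ-≤ (T * T * #valid W) (*-monoˡ-≤ (2 * A * c) (degree≤D v)) ⟩
        T * T * #valid W + D * (2 * A * c) ∎

    -- On the empty set all `T ^ V` assignments are valid, and by halving each further vertex keeps
    -- the count positive.
    #valid-positive : ∀ s W → ∣ W ∣ ≤ s → 1 ≤ #valid W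
    #valid-positive s W ∣W∣≤s with nonempty? W
    ... | no empty = begin
      1                        ≤⟨ >-nonZero⁻¹ (T ^ V) {{m^n≢0 T V {{>-nonZero T>0}}}} ⟩
      T ^ V                    ≡⟨ length-vecs T V ⟨
      length (vecs T V)        ≡⟨ *-identityʳ _ ⟨
      length (vecs T V) * 1    ≡⟨ ∑-const (vecs T V) 1 ⟨
      ∑ (vecs T V) (λ _ → 1)   ≡⟨ ∑-cong (vecs T V) (λ f → sym (𝟙-true (valid? W f) (λ j p∈ _ _ → empty (p j , p∈)))) ⟩
      #valid W                 ∎
      where open ≤-Reasoning
    #valid-positive zero    W ∣W∣≤0 | yes (v , v∈W) = contradiction (<-≤-trans (x∈p⇒∣p-x∣<∣p∣ v∈W) ∣W∣≤0) (λ ())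
    #valid-positive (suc s) W ∣W∣≤s | yes (v , v∈W) with #valid W in eq
    ... | suc _ = s≤s z≤n
    ... | zero  = contradiction
      (≤-trans (#valid-positive s (W - v) (s≤s⁻¹ (<-≤-trans (x∈p⇒∣p-x∣<∣p∣ v∈W) ∣W∣≤s)))
        (≤-trans (#valid-halving (suc s) W ∣W∣≤s v v∈W) (≤-reflexive (cong (2 *_) eq)))) (λ ())

    solution : ∃ λ f → ∀ j → ¬ Bad j (lookup f (p j)) (lookup f (q j))
    solution with ∑-positive (vecs T V) _ (#valid-positive _ ⊤ ≤-refl)
    ... | f , f-valid with valid? ⊤ f
    ... | yes valid = f , λ j → valid j ∈⊤ ∈⊤

-- The iterated exponential

-- multiset j N = C(N + j − 1, j), the coefficients of (1 − y)^(−N).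
multiset : ℕ → ℕ → ℕ
multiset zero    N       = 1
multiset (suc j) zero    = 0
multiset (suc j) (suc N) = multiset (suc j) N + multiset j (suc N)

-- In fact `suc j * multiset (suc j) N` equals `(N + j) * multiset j N`. Hence `N ^ j / j!` is at
-- most `multiset j N`, which compares the exponential series with a binomial series.
N*multiset≤ : ∀ j N → N * multiset j N ≤ suc j * multiset (suc j) N
N*multiset≤ j       zero    = z≤n
N*multiset≤ zero    (suc N) = begin
  suc N * 1                               ≡⟨ r₁ N ⟩
  N * 1 + 1                             ≤⟨ +-monoˡ-≤ 1 (N*multiset≤ zero N) ⟩
  1 * multiset 1 N + 1                  ≡⟨ r₂ (multiset 1 N) ⟩
  1 * (multiset 1 N + 1)                ∎
  where
  open ≤-Reasoning
  r₁ : ∀ N → suc N * 1 ≡ N * 1 + 1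
  r₁ = solve-∀
  r₂ : ∀ N → 1 * N + 1 ≡ 1 * (N + 1)
  r₂ = solve-∀
N*multiset≤ (suc j) (suc N) = begin
  suc N * (x + y)                       ≡⟨ r₁ N x y ⟩
  N * x + suc N * y + x             ≤⟨ +-monoˡ-≤ x (+-mono-≤ (N*multiset≤ (suc j) N) (N*multiset≤ j (suc N))) ⟩
  suc (suc j) * z + suc j * (x + y) + x ≤⟨ m≤m+n _ y ⟩
  suc (suc j) * z + suc j * (x + y) + x + y ≡⟨ r₂ j x y z ⟩
  suc (suc j) * (z + (x + y))         ∎
  where
  open ≤-Reasoning
  x = multiset (suc j) N
  y = multiset j (suc N)
  z = multiset (suc (suc j)) N
  r₁ : ∀ N x y → suc N * (x + y) ≡ N * x + suc N * y + x
  r₁ = solve-∀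
  r₂ : ∀ j x y z → suc (suc j) * z + suc j * (x + y) + x + y ≡ suc (suc j) * (z + (x + y))
  r₂ = solve-∀

-- 2^J times the partial sum of (1 − 1/2)^(−N) = 2^N.
scaledSum : ℕ → ℕ → ℕ
scaledSum zero    N = 0
scaledSum (suc J) N = 2 * (scaledSum J N + multiset J N)

-- Summed form of the recursion of `multiset`, that is of multiplying the series by 1 - y at y =
-- 1/2; the shift of the index uses up one factor 2.
scaledSum-pascal : ∀ J N → scaledSum (suc J) (suc N) ≡ scaledSum (suc J) N + scaledSum J (suc N)
scaledSum-pascal zero    N = refl
scaledSum-pascal (suc J) N = trans
  (cong (λ s → 2 * (s + (multiset (suc J) N + multiset J (suc N)))) (scaledSum-pascal J N))
  (r (scaledSum (suc J) N) (scaledSum J (suc N)) (multiset (suc J) N) (multiset J (suc N)))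
  where
  r : ∀ s t x y → 2 * (s + t + (x + y)) ≡ 2 * (s + x) + 2 * (t + y)
  r = solve-∀

scaledSum-zero : ∀ J → scaledSum (suc J) 0 ≡ 2 ^ suc J
scaledSum-zero zero    = refl
scaledSum-zero (suc J) = cong (2 *_) (trans (+-identityʳ _) (scaledSum-zero J))

scaledSum≤ : ∀ J N → scaledSum J N ≤ 2 ^ J * 2 ^ N
scaledSum≤ zero    N       = z≤n
scaledSum≤ (suc J) zero    = ≤-reflexive (trans (scaledSum-zero J) (sym (*-identityʳ _)))
scaledSum≤ (suc J) (suc N) = begin
  scaledSum (suc J) (suc N)                              ≡⟨ scaledSum-pascal J N ⟩
  scaledSum (suc J) N + scaledSum J (suc N)            ≤⟨ +-mono-≤ (scaledSum≤ (suc J) N) (scaledSum≤ J (suc N)) ⟩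
  2 ^ suc J * 2 ^ N + 2 ^ J * 2 ^ suc N    ≡⟨ r (2 ^ J) (2 ^ N) ⟩
  2 ^ suc J * 2 ^ suc N                            ∎
  where
  open ≤-Reasoning
  r : ∀ a b → 2 * a * b + a * (2 * b) ≡ 2 * a * (2 * b)
  r = solve-∀

-- Fractions and the embedding of the natural numbers

fraction-mono-≤ : ∀ m n c d .{{_ : NonZero c}} .{{_ : NonZero d}} →
           m * d ≤ n * c → (ℤ.+ m) ℚ./ c ℚ.≤ (ℤ.+ n) ℚ./ d
fraction-mono-≤ m n (suc c) (suc d) h = ℚ.toℚᵘ-cancel-≤
  (ℚᵘ.≤-respˡ-≃ (ℚᵘ.≃-sym (ℚ.toℚᵘ-fromℚᵘ (ℚᵘ.mkℚᵘ (ℤ.+ m) c))) (ℚᵘ.≤-respʳ-≃ (ℚᵘ.≃-sym (ℚ.toℚᵘ-fromℚᵘ (ℚᵘ.mkℚᵘ (ℤ.+ n) d)))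
    (ℚᵘ.*≤* (subst₂ ℤ._≤_ (ℤ.pos-* m (suc d)) (ℤ.pos-* n (suc c)) (ℤ.+≤+ h)))))

fraction-* : ∀ m n c d .{{_ : NonZero c}} .{{_ : NonZero d}} .{{_ : NonZero (c * d)}} →
        (ℤ.+ m) ℚ./ c ℚ.* ((ℤ.+ n) ℚ./ d) ≡ (ℤ.+ (m * n)) ℚ./ (c * d)
fraction-* m n (suc c) (suc d) = ℚ.toℚᵘ-injective (begin
  ℚ.toℚᵘ ((ℤ.+ m) ℚ./ suc c ℚ.* ((ℤ.+ n) ℚ./ suc d))
    ≈⟨ ℚ.toℚᵘ-homo-* ((ℤ.+ m) ℚ./ suc c) ((ℤ.+ n) ℚ./ suc d) ⟩
  ℚ.toℚᵘ ((ℤ.+ m) ℚ./ suc c) ℚᵘ.* ℚ.toℚᵘ ((ℤ.+ n) ℚ./ suc d)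
    ≈⟨ ℚᵘ.*-cong (ℚ.toℚᵘ-fromℚᵘ (ℚᵘ.mkℚᵘ (ℤ.+ m) c)) (ℚ.toℚᵘ-fromℚᵘ (ℚᵘ.mkℚᵘ (ℤ.+ n) d)) ⟩
  ℚᵘ.mkℚᵘ (ℤ.+ m) c ℚᵘ.* ℚᵘ.mkℚᵘ (ℤ.+ n) d
    ≈⟨ ℚᵘ.*≡* (cong (ℤ._* (ℤ.+ (suc c * suc d))) (sym (ℤ.pos-* m n))) ⟩
  ℚᵘ.mkℚᵘ (ℤ.+ (m * n)) (d + c * suc d)
    ≈⟨ ℚᵘ.≃-sym (ℚ.toℚᵘ-fromℚᵘ (ℚᵘ.mkℚᵘ (ℤ.+ (m * n)) (d + c * suc d))) ⟩
  ℚ.toℚᵘ ((ℤ.+ (m * n)) ℚ./ (suc c * suc d)) ∎)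
  where open ℚᵘ.≃-Reasoning

ℕ→ℚ-mono-≤ : ∀ {m n} → m ≤ n → ℕ→ℚ m ℚ.≤ ℕ→ℚ n
ℕ→ℚ-mono-≤ {m} {n} m≤n = fraction-mono-≤ m n 1 1 (*-monoˡ-≤ 1 m≤n)

ℕ→ℚ-cancel-< : ∀ {m n} → ℕ→ℚ m ℚ.< ℕ→ℚ n → m < n
ℕ→ℚ-cancel-< m<n = ≰⇒> (λ n≤m → ℚ.<-irrefl refl (ℚ.<-≤-trans m<n (ℕ→ℚ-mono-≤ n≤m)))

ℕ→ℚ-* : ∀ m n → ℕ→ℚ (m * n) ≡ ℕ→ℚ m ℚ.* ℕ→ℚ n
ℕ→ℚ-* m n = sym (fraction-* m n 1 1)

ℕ→ℚ-+ : ∀ m n → ℕ→ℚ (m + n) ≡ ℕ→ℚ m ℚ.+ ℕ→ℚ n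
ℕ→ℚ-+ m n = ℚ.toℚᵘ-injective (begin
  ℚ.toℚᵘ (ℕ→ℚ (m + n))
    ≈⟨ ℚ.toℚᵘ-fromℚᵘ (ℚᵘ.mkℚᵘ (ℤ.+ (m + n)) 0) ⟩
  ℚᵘ.mkℚᵘ (ℤ.+ (m + n)) 0
    ≈⟨ ℚᵘ.*≡* (cong (ℤ._* (ℤ.+ 1)) (trans (ℤ.pos-+ m n) (sym (cong₂ ℤ._+_ (ℤ.*-identityʳ (ℤ.+ m)) (ℤ.*-identityʳ (ℤ.+ n)))))) ⟩
  ℚᵘ.mkℚᵘ (ℤ.+ m) 0 ℚᵘ.+ ℚᵘ.mkℚᵘ (ℤ.+ n) 0
    ≈⟨ ℚᵘ.≃-sym (ℚᵘ.+-cong (ℚ.toℚᵘ-fromℚᵘ (ℚᵘ.mkℚᵘ (ℤ.+ m) 0)) (ℚ.toℚᵘ-fromℚᵘ (ℚᵘ.mkℚᵘ (ℤ.+ n) 0))) ⟩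
  ℚ.toℚᵘ (ℕ→ℚ m) ℚᵘ.+ ℚ.toℚᵘ (ℕ→ℚ n)
    ≈⟨ ℚᵘ.≃-sym (ℚ.toℚᵘ-homo-+ (ℕ→ℚ m) (ℕ→ℚ n)) ⟩
  ℚ.toℚᵘ (ℕ→ℚ m ℚ.+ ℕ→ℚ n) ∎)
  where open ℚᵘ.≃-Reasoning

suc-reciprocal : ∀ j → ℕ→ℚ (suc j) ℚ.* ((ℤ.+ 1) ℚ./ suc j) ≡ 1ℚ
suc-reciprocal j = trans (fraction-* (suc j) 1 1 (suc j)) (ℚ.≤-antisym
  (fraction-mono-≤ (suc j * 1) 1 (1 * suc j) 1 (≤-reflexive (r j))) (fraction-mono-≤ 1 (suc j * 1) 1 (1 * suc j) (≤-reflexive (sym (r j)))))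
  where
  r : ∀ j → suc j * 1 * 1 ≡ 1 * (1 * suc j)
  r = solve-∀

*-mono-≤-nonNeg : ∀ {p q r s} → 0ℚ ℚ.≤ r → 0ℚ ℚ.≤ q → p ℚ.≤ q → r ℚ.≤ s → p ℚ.* r ℚ.≤ q ℚ.* s
*-mono-≤-nonNeg {p} {q} {r} {s} 0≤r 0≤q p≤q r≤s = ℚ.≤-trans
  (ℚ.*-monoʳ-≤-nonNeg r {{ℚ.nonNegative 0≤r}} p≤q) (ℚ.*-monoˡ-≤-nonNeg q {{ℚ.nonNegative 0≤q}} r≤s)

*-nonNeg : ∀ {p q} → 0ℚ ℚ.≤ p → 0ℚ ℚ.≤ q → 0ℚ ℚ.≤ p ℚ.* q
*-nonNeg 0≤p 0≤q = *-mono-≤-nonNeg {p = 0ℚ} {r = 0ℚ} ℚ.≤-refl 0≤p 0≤p 0≤q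

1/suc-nonNeg : ∀ j → 0ℚ ℚ.≤ (ℤ.+ 1) ℚ./ suc j
1/suc-nonNeg j = fraction-mono-≤ 0 1 1 (suc j) z≤n

-- Bounds for the exponential series

expTerm-nonNeg : ∀ j {x} → 0ℚ ℚ.≤ x → 0ℚ ℚ.≤ expTerm j x
expTerm-nonNeg zero    0≤x = ℕ→ℚ-mono-≤ {0} {1} z≤n
expTerm-nonNeg (suc j) 0≤x = *-nonNeg (*-nonNeg (expTerm-nonNeg j 0≤x) 0≤x) (1/suc-nonNeg j)

expPartial-nonNeg : ∀ J {x} → 0ℚ ℚ.≤ x → 0ℚ ℚ.≤ expPartial J x
expPartial-nonNeg zero    0≤x = ℚ.≤-refl
expPartial-nonNeg (suc J) 0≤x = ℚ.+-mono-≤ {0ℚ} {_} {0ℚ} (expPartial-nonNeg J 0≤x) (expTerm-nonNeg J 0≤x)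

-- The left side is `(2x) ^ j / j!`, at most `N ^ j / j!`; `N*multiset≤` passes from this to the
-- binomial coefficient one factor at a time.
expTerm≤ : ∀ {x N} → 0ℚ ℚ.≤ x → x ℚ.* ℕ→ℚ 2 ℚ.≤ ℕ→ℚ N → ∀ j → expTerm j x ℚ.* ℕ→ℚ (2 ^ j) ℚ.≤ ℕ→ℚ (multiset j N)
expTerm≤ 0≤x 2x≤N zero = ℚ.≤-refl
expTerm≤ {x} {N} 0≤x 2x≤N (suc j) = begin
  t ℚ.* x ℚ.* r ℚ.* ℕ→ℚ (2 ^ suc j)          ≡⟨ cong (t ℚ.* x ℚ.* r ℚ.*_) (ℕ→ℚ-* 2 (2 ^ j)) ⟩
  t ℚ.* x ℚ.* r ℚ.* (ℕ→ℚ 2 ℚ.* P)              ≡⟨ rearrange t x r (ℕ→ℚ 2) P ⟩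
  (t ℚ.* P) ℚ.* (x ℚ.* ℕ→ℚ 2) ℚ.* r            ≤⟨ ℚ.*-monoʳ-≤-nonNeg r {{ℚ.nonNegative (1/suc-nonNeg j)}}
                                                    (*-mono-≤-nonNeg (*-nonNeg 0≤x (ι≥0 2)) (ι≥0 (multiset j N)) (expTerm≤ {N = N} 0≤x 2x≤N j) 2x≤N) ⟩
  ℕ→ℚ (multiset j N) ℚ.* ℕ→ℚ N ℚ.* r           ≡⟨ cong (ℚ._* r) (trans (ℚ.*-comm (ℕ→ℚ (multiset j N)) (ℕ→ℚ N)) (sym (ℕ→ℚ-* N (multiset j N)))) ⟩
  ℕ→ℚ (N * multiset j N) ℚ.* r               ≤⟨ ℚ.*-monoʳ-≤-nonNeg r {{ℚ.nonNegative (1/suc-nonNeg j)}} (ℕ→ℚ-mono-≤ (N*multiset≤ j N)) ⟩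
  ℕ→ℚ (suc j * multiset (suc j) N) ℚ.* r     ≡⟨ cong (ℚ._* r) (trans (ℕ→ℚ-* (suc j) (multiset (suc j) N)) (ℚ.*-comm (ℕ→ℚ (suc j)) (ℕ→ℚ (multiset (suc j) N)))) ⟩
  ℕ→ℚ (multiset (suc j) N) ℚ.* ℕ→ℚ (suc j) ℚ.* r ≡⟨ ℚ.*-assoc (ℕ→ℚ (multiset (suc j) N)) (ℕ→ℚ (suc j)) r ⟩
  ℕ→ℚ (multiset (suc j) N) ℚ.* (ℕ→ℚ (suc j) ℚ.* r) ≡⟨ cong (ℕ→ℚ (multiset (suc j) N) ℚ.*_) (suc-reciprocal j) ⟩
  ℕ→ℚ (multiset (suc j) N) ℚ.* 1ℚ              ≡⟨ ℚ.*-identityʳ _ ⟩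
  ℕ→ℚ (multiset (suc j) N)                     ∎
  where
  open ℚ.≤-Reasoning
  t = expTerm j x
  r = (ℤ.+ 1) ℚ./ suc j
  P = ℕ→ℚ (2 ^ j)
  ι≥0 : ∀ n → 0ℚ ℚ.≤ ℕ→ℚ n
  ι≥0 n = ℕ→ℚ-mono-≤ {0} {n} z≤n
  rearrange : ∀ t x r s p → t ℚ.* x ℚ.* r ℚ.* (s ℚ.* p) ≡ (t ℚ.* p) ℚ.* (x ℚ.* s) ℚ.* r
  rearrange = solve 5 (λ t x r s p → t :* x :* r :* (s :* p) := (t :* p) :* (x :* s) :* r) refl

expPartial-scaled≤ : ∀ {x N} → 0ℚ ℚ.≤ x → x ℚ.* ℕ→ℚ 2 ℚ.≤ ℕ→ℚ N → ∀ J →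
                     expPartial J x ℚ.* ℕ→ℚ (2 ^ J) ℚ.≤ ℕ→ℚ (scaledSum J N)
expPartial-scaled≤ 0≤x 2x≤N zero = ℚ.≤-refl
expPartial-scaled≤ {x} {N} 0≤x 2x≤N (suc J) = begin
  (E ℚ.+ t) ℚ.* ℕ→ℚ (2 ^ suc J)                          ≡⟨ cong ((E ℚ.+ t) ℚ.*_) (ℕ→ℚ-* 2 (2 ^ J)) ⟩
  (E ℚ.+ t) ℚ.* (ℕ→ℚ 2 ℚ.* P)                              ≡⟨ rearrange E t (ℕ→ℚ 2) P ⟩
  ℕ→ℚ 2 ℚ.* (E ℚ.* P ℚ.+ t ℚ.* P)                          ≤⟨ ℚ.*-monoˡ-≤-nonNeg (ℕ→ℚ 2) (ℚ.+-mono-≤ (expPartial-scaled≤ {N = N} 0≤x 2x≤N J) (expTerm≤ {N = N} 0≤x 2x≤N J)) ⟩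
  ℕ→ℚ 2 ℚ.* (ℕ→ℚ (scaledSum J N) ℚ.+ ℕ→ℚ (multiset J N))   ≡⟨ cong (ℕ→ℚ 2 ℚ.*_) (ℕ→ℚ-+ (scaledSum J N) (multiset J N)) ⟨
  ℕ→ℚ 2 ℚ.* ℕ→ℚ (scaledSum J N + multiset J N)           ≡⟨ ℕ→ℚ-* 2 (scaledSum J N + multiset J N) ⟨
  ℕ→ℚ (scaledSum (suc J) N)                                ∎
  where
  open ℚ.≤-Reasoning
  E = expPartial J x
  t = expTerm J x
  P = ℕ→ℚ (2 ^ J)
  rearrange : ∀ e t s p → (e ℚ.+ t) ℚ.* (s ℚ.* p) ≡ s ℚ.* (e ℚ.* p ℚ.+ t ℚ.* p)
  rearrange = solve 4 (λ e t s p → (e :+ t) :* (s :* p) := s :* (e :* p :+ t :* p)) refl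

-- A rational substitute for e^x ≤ 4^x: for an integer N ≥ 2x the series is dominated termwise by
-- that of (1 - 1/2)^(-N) = 2^N.
expPartial≤ : ∀ {x N} → 0ℚ ℚ.≤ x → x ℚ.* ℕ→ℚ 2 ℚ.≤ ℕ→ℚ N → ∀ J → expPartial J x ℚ.≤ ℕ→ℚ (2 ^ N)
expPartial≤ {x} {N} 0≤x 2x≤N J = ℚ.*-cancelʳ-≤-pos (ℕ→ℚ (2 ^ J)) {{positive}} (begin
  expPartial J x ℚ.* ℕ→ℚ (2 ^ J)     ≤⟨ expPartial-scaled≤ {N = N} 0≤x 2x≤N J ⟩
  ℕ→ℚ (scaledSum J N)                  ≤⟨ ℕ→ℚ-mono-≤ (scaledSum≤ J N) ⟩
  ℕ→ℚ (2 ^ J * 2 ^ N)            ≡⟨ trans (ℕ→ℚ-* (2 ^ J) (2 ^ N)) (ℚ.*-comm (ℕ→ℚ (2 ^ J)) (ℕ→ℚ (2 ^ N))) ⟩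
  ℕ→ℚ (2 ^ N) ℚ.* ℕ→ℚ (2 ^ J)      ∎)
  where
  open ℚ.≤-Reasoning
  positive : ℚ.Positive (ℕ→ℚ (2 ^ J))
  positive = ℚ.positive (ℚ.<-≤-trans (ℚ.positive⁻¹ 1ℚ) (ℕ→ℚ-mono-≤ {1} {2 ^ J} (>-nonZero⁻¹ _ {{m^n≢0 2 J}})))

-- `expPartial≤` is applied twice: the inner sum is at most `2 ^ N`, so its double is at most
-- `2 ^ suc N`, which serves as `N` for the outer sum.
LeExpExp⇒≤ : ∀ {k x N} → 0ℚ ℚ.≤ x → x ℚ.* ℕ→ℚ 2 ℚ.≤ ℕ→ℚ N → LeExpExp k x → k ≤ 2 ^ (2 ^ suc N)
-- `δ = 1` is enough: between natural numbers `k < a + 1` means `k ≤ a`.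
LeExpExp⇒≤ {k} {x} {N} 0≤x 2x≤N le with le 1ℚ (ℚ.positive⁻¹ 1ℚ)
... | m₁ , m₂ , k< = s≤s⁻¹ (ℕ→ℚ-cancel-< {k} {suc (2 ^ (2 ^ suc N))} (ℚ.<-≤-trans k< (begin
  expPartial m₂ y ℚ.+ 1ℚ                    ≤⟨ ℚ.+-monoˡ-≤ 1ℚ (expPartial≤ {N = 2 ^ suc N} (expPartial-nonNeg m₁ 0≤x) 2y≤ m₂) ⟩
  ℕ→ℚ (2 ^ (2 ^ suc N)) ℚ.+ ℕ→ℚ 1       ≡⟨ ℕ→ℚ-+ (2 ^ (2 ^ suc N)) 1 ⟨
  ℕ→ℚ (2 ^ (2 ^ suc N) + 1)           ≡⟨ cong ℕ→ℚ (+-comm (2 ^ (2 ^ suc N)) 1) ⟩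
  ℕ→ℚ (suc (2 ^ (2 ^ suc N)))           ∎)))
  where
  open ℚ.≤-Reasoning
  y = expPartial m₁ x
  2y≤ : y ℚ.* ℕ→ℚ 2 ℚ.≤ ℕ→ℚ (2 ^ suc N)
  2y≤ = begin
    y ℚ.* ℕ→ℚ 2                 ≤⟨ ℚ.*-monoʳ-≤-nonNeg (ℕ→ℚ 2) (expPartial≤ {N = N} 0≤x 2x≤N m₁) ⟩
    ℕ→ℚ (2 ^ N) ℚ.* ℕ→ℚ 2     ≡⟨ trans (ℚ.*-comm (ℕ→ℚ (2 ^ N)) (ℕ→ℚ 2)) (sym (ℕ→ℚ-* 2 (2 ^ N))) ⟩
    ℕ→ℚ (2 ^ suc N)           ∎

ThresholdLe⇒≤ : ∀ {k n N} → n ≤ N * (1000 * (suc k * suc k)) → ThresholdLe (suc k) n →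
                suc k ≤ 2 ^ (2 ^ suc N)
ThresholdLe⇒≤ {k} {n} {N} n≤ = LeExpExp⇒≤ {N = N}
  (fraction-mono-≤ 0 n 1 (2000 * suc k * suc k) z≤n)
  (ℚ.≤-trans (ℚ.≤-reflexive (fraction-* n 2 (2000 * suc k * suc k) 1)) (fraction-mono-≤ (n * 2) N (2000 * suc k * suc k * 1) 1 (begin
    n * 2 * 1                                      ≡⟨ *-identityʳ _ ⟩
    n * 2                                            ≤⟨ *-monoˡ-≤ 2 n≤ ⟩
    N * (1000 * (suc k * suc k)) * 2           ≡⟨ r N (suc k) ⟩
    N * (2000 * suc k * suc k * 1)             ∎)))
  where
  open ≤-Reasoning
  r : ∀ N k → N * (1000 * (k * k)) * 2 ≡ N * (2000 * k * k * 1)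
  r = solve-∀

-- From permutations to independent colourings

perms : ∀ n → List (Permutation′ n)
perms zero    = Perm.id ∷ []
perms (suc n) = concatMap (λ j → map (Perm.insert zero j) (perms n)) (allFin (suc n))

length-perms : ∀ n → length (perms n) ≡ n !
length-perms zero    = refl
length-perms (suc n) = begin
  length (perms (suc n))                             ≡⟨ *-identityʳ _ ⟨
  length (perms (suc n)) * 1                         ≡⟨ ∑-const (perms (suc n)) 1 ⟨
  ∑ (perms (suc n)) (λ _ → 1)                        ≡⟨ ∑-concatMap (λ j → map (Perm.insert zero j) (perms n)) (allFin (suc n)) (λ _ → 1) ⟩
  ∑ (allFin (suc n)) (λ j → ∑ (map (Perm.insert zero j) (perms n)) (λ _ → 1))
    ≡⟨ ∑-cong (allFin (suc n)) (λ j → trans (∑-map (Perm.insert zero j) (perms n) _) (trans (∑-const (perms n) 1) (*-identityʳ _))) ⟩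
  ∑ (allFin (suc n)) (λ _ → length (perms n))        ≡⟨ ∑-const (allFin (suc n)) _ ⟩
  length (allFin (suc n)) * length (perms n)         ≡⟨ cong₂ _*_ (length-allFin (suc n)) (length-perms n) ⟩
  suc n * n !                                        ∎
  where open ≡-Reasoning

-- A permutation is rebuilt from its value at `zero` and the rest. Agreement is pointwise, since
-- permutations are records of functions; the covering list is compared pointwise too.
perms-complete : ∀ {n} (σ : Permutation′ n) → ∃ λ ρ → ρ ∈ perms n × (∀ i → ρ ⟨$⟩ʳ i ≡ σ ⟨$⟩ʳ i)
perms-complete {zero}  σ = Perm.id , here refl , λ ()
perms-complete {suc n} σ with perms-complete (Perm.remove zero σ)
... | ρ , ρ∈ , ρ≈ = Perm.insert zero (σ ⟨$⟩ʳ zero) ρ ,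
  ∈-concatMap⁺ (λ j → map (Perm.insert zero j) (perms n)) (lose (∈-allFin (σ ⟨$⟩ʳ zero)) (∈-map⁺ _ ρ∈)) ,
  λ { zero    → refl
    ; (suc i) → trans (Perm.insert-punchIn zero (σ ⟨$⟩ʳ zero) ρ i)
                  (trans (cong (punchIn (σ ⟨$⟩ʳ zero)) (ρ≈ i)) (sym (Perm.punchIn-permute σ zero i))) }

Monotone : ∀ {n M} → (Fin n → Fin M) → Set
Monotone z = ∀ i j → i Fin.≤ j → z i Fin.≤ z j

argmin : ∀ {n M} (u : Fin (suc n) → Fin M) → ∃ λ j → ∀ i → u j Fin.≤ u i
argmin {zero}  u = zero , λ { zero → ≤-refl }
argmin {suc n} u with argmin (u ∘ suc)
... | j , minimal with ≤-total (toℕ (u zero)) (toℕ (u (suc j)))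
... | inj₁ le = zero  , λ { zero → ≤-refl ; (suc i) → ≤-trans le (minimal i) }
... | inj₂ ge = suc j , λ { zero → ge ; (suc i) → minimal i }

-- Selection sort: an index of least colour comes first, then the others are sorted recursively.
sort : ∀ {n M} (u : Fin n → Fin M) → ∃ λ (τ : Permutation′ n) → Monotone (u ∘ (τ ⟨$⟩ʳ_))
sort {zero}  u = Perm.id , λ ()
sort {suc n} u with argmin u
... | j , minimal with sort (u ∘ punchIn j)
... | τ , mono = Perm.insert zero j τ , λ
  { zero    i       _         → minimal _
  ; (suc i) (suc k) (s≤s i≤k) → subst₂ (λ a b → u a Fin.≤ u b)
      (sym (Perm.insert-punchIn zero j τ i)) (sym (Perm.insert-punchIn zero j τ k)) (mono i k i≤k) }

-- For fixed σ the colouring u ∘ σ is uniform when u is, so averaging over σ as well finds one u that is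
-- good for most σ; sorting u then replaces σ by τ⁻¹ ∘ σ.
cover : ∀ {M n} (P : Permutation′ n → Set) (F : (Fin n → Fin M) → ℕ) (c d : ℕ) → 1 ≤ M →
        (∀ σ → ∑ (vecs M n) (λ u → F (lookup u ∘ (σ ⟨$⟩ʳ_))) * d ≤ c * M ^ n) →
        (∀ z → Monotone z → ∀ v σ → (∀ i → v i ≡ z (σ ⟨$⟩ʳ i)) → F v ≡ 0 → P σ) →
        ∃ λ (L : List (Fin n → Fin n)) → length L * d ≤ c * n ! ×
          (∀ σ → ¬ P σ → Any (λ τ → ∀ i → σ ⟨$⟩ʳ i ≡ τ i) L)
cover {M} {n} P F c d M>0 expected good = L , length-L , covers
  where
  open ≤-Reasoning

  weight : Vec (Fin M) n → ℕ
  weight u = ∑ (perms n) (λ σ → F (lookup u ∘ (σ ⟨$⟩ʳ_)) * d)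

  total : ∑ (vecs M n) weight ≤ length (vecs M n) * (c * n !)
  total = begin
    ∑ (vecs M n) weight
      ≡⟨ ∑-swap (vecs M n) (perms n) _ ⟩
    ∑ (perms n) (λ σ → ∑ (vecs M n) (λ u → F (lookup u ∘ (σ ⟨$⟩ʳ_)) * d))
      ≡⟨ ∑-cong (perms n) (λ σ → ∑-*ʳ (vecs M n) (λ u → F (lookup u ∘ (σ ⟨$⟩ʳ_))) d) ⟩
    ∑ (perms n) (λ σ → ∑ (vecs M n) (λ u → F (lookup u ∘ (σ ⟨$⟩ʳ_))) * d)
      ≤⟨ ∑-bound (perms n) (λ {σ} _ → expected σ) ⟩
    length (perms n) * (c * M ^ n)
      ≡⟨ cong (_* (c * M ^ n)) (length-perms n) ⟩
    n ! * (c * M ^ n)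
      ≡⟨ rearrange (n !) c (M ^ n) ⟩
    M ^ n * (c * n !)
      ≡⟨ cong (_* (c * n !)) (length-vecs M n) ⟨
    length (vecs M n) * (c * n !)
      ∎
    where
    rearrange : ∀ a b e → a * (b * e) ≡ e * (b * a)
    rearrange = solve-∀

  light : ∃ λ u → weight u ≤ c * n !
  light with vecs M n | length-vecs M n | total
  -- Averaging needs a nonempty list; `1 ≤ M` makes `M ^ n` positive.
  ... | []     | eq | _ = contradiction (sym eq) (≢-nonZero⁻¹ (M ^ n) {{m^n≢0 M n {{>-nonZero M>0}}}})
  ... | x ∷ xs | _  | h = ∑-average x xs weight (c * n !) h

  u = proj₁ light
  τ = proj₁ (sort (lookup u))

  bad? : ∀ σ → Dec (¬ F (lookup u ∘ (σ ⟨$⟩ʳ_)) ≡ 0)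
  bad? σ = ¬? (F (lookup u ∘ (σ ⟨$⟩ʳ_)) ≟ 0)

  toFun : Permutation′ n → Fin n → Fin n
  toFun σ i = τ ⟨$⟩ˡ (σ ⟨$⟩ʳ i)

  L : List (Fin n → Fin n)
  L = map toFun (filter bad? (perms n))

  length-L : length L * d ≤ c * n !
  length-L = begin
    length L * d
      ≡⟨ cong (_* d) (trans (length-map toFun (filter bad? (perms n))) (length-filter-∑ bad? (perms n))) ⟩
    ∑ (perms n) (λ σ → 𝟙 (bad? σ)) * d
      -- Markov's inequality: `F` takes natural numbers as values, so it is at least 1 where it does
      -- not vanish.
      ≤⟨ *-monoˡ-≤ d (∑-mono (perms n) (λ {σ} _ → 𝟙-≤ (bad? σ) n≢0⇒n>0)) ⟩
    ∑ (perms n) (λ σ → F (lookup u ∘ (σ ⟨$⟩ʳ_))) * d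
      ≡⟨ ∑-*ʳ (perms n) (λ σ → F (lookup u ∘ (σ ⟨$⟩ʳ_))) d ⟨
    weight u
      ≤⟨ proj₂ light ⟩
    c * n !
      ∎

  covers : ∀ σ → ¬ P σ → Any (λ τ′ → ∀ i → σ ⟨$⟩ʳ i ≡ τ′ i) L
  -- `ρ` is `τ` after `σ`, so `u ∘ ρ` is the sorted colouring `u ∘ τ` composed with `σ`; undoing `τ`
  -- in `toFun` gives back `σ`. All this holds pointwise, hence the separate `v` in `good`.
  covers σ ¬Pσ with perms-complete (σ ∘ₚ τ)
  ... | ρ , ρ∈ , ρ≈ = lose (∈-map⁺ toFun (∈-filter⁺ bad? ρ∈ Fρ≢0))
    (λ i → sym (trans (cong (τ ⟨$⟩ˡ_) (ρ≈ i)) (Perm.inverseˡ τ)))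
    where
    Fρ≢0 : ¬ F (lookup u ∘ (ρ ⟨$⟩ʳ_)) ≡ 0
    Fρ≢0 F≡0 = ¬Pσ (good (lookup u ∘ (τ ⟨$⟩ʳ_)) (proj₂ (sort (lookup u))) (lookup u ∘ (ρ ⟨$⟩ʳ_)) σ
      (λ i → cong (lookup u) (ρ≈ i)) F≡0)

-- Empty cells

comb : {A : Set} → ℕ → List A → List (List A)
comb zero    xs       = [] ∷ []
comb (suc m) []       = []
comb (suc m) (x ∷ xs) = map (x ∷_) (comb m xs) ++ comb (suc m) xs

-- A crude bound on a binomial coefficient; the emptiness probability later outweighs the resulting
-- `(b * b) ^ m`.
length-comb : {A : Set} (m : ℕ) (xs : List A) → length (comb m xs) ≤ length xs ^ m
length-comb zero    xs       = ≤-refl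
length-comb (suc m) []       = z≤n
length-comb (suc m) (x ∷ xs) = begin
  length (map (x ∷_) (comb m xs) ++ comb (suc m) xs)            ≡⟨ length-++ (map (x ∷_) (comb m xs)) ⟩
  length (map (x ∷_) (comb m xs)) + length (comb (suc m) xs)    ≡⟨ cong (_+ length (comb (suc m) xs)) (length-map (x ∷_) (comb m xs)) ⟩
  length (comb m xs) + length (comb (suc m) xs)                 ≤⟨ +-mono-≤ (length-comb m xs) (length-comb (suc m) xs) ⟩
  length xs ^ m + length xs * length xs ^ m                     ≡⟨⟩
  suc (length xs) * length xs ^ m                               ≤⟨ *-monoʳ-≤ (suc (length xs)) (^-monoˡ-≤ m (n≤1+n (length xs))) ⟩
  suc (length xs) ^ suc m                                       ∎
  where open ≤-Reasoning

comb⇒length : {A : Set} (m : ℕ) (xs : List A) {ys : List A} → ys ∈ comb m xs → length ys ≡ m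
comb⇒length zero    xs       (here refl) = refl
comb⇒length (suc m) (x ∷ xs) ys∈ with ∈-++⁻ (map (x ∷_) (comb m xs)) ys∈
... | inj₂ p = comb⇒length (suc m) xs p
... | inj₁ p with ∈-map⁻ (x ∷_) p
... | zs , zs∈ , refl = cong suc (comb⇒length m xs zs∈)

comb⇒⊆ : {A : Set} (m : ℕ) (xs : List A) {ys : List A} → ys ∈ comb m xs → ys ⊆ xs
comb⇒⊆ zero    xs       (here refl) ()
comb⇒⊆ (suc m) (x ∷ xs) ys∈ y∈ with ∈-++⁻ (map (x ∷_) (comb m xs)) ys∈
... | inj₂ p = there (comb⇒⊆ (suc m) xs p y∈)
... | inj₁ p with ∈-map⁻ (x ∷_) p | y∈
... | zs , zs∈ , refl | here e   = here e
... | zs , zs∈ , refl | there q  = there (comb⇒⊆ m xs zs∈ q)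

comb⇒Unique : {A : Set} (m : ℕ) (xs : List A) {ys : List A} → Unique xs → ys ∈ comb m xs → Unique ys
comb⇒Unique zero    xs       _ (here refl) = []
comb⇒Unique (suc m) (x ∷ xs) (x≢ ∷ u) ys∈ with ∈-++⁻ (map (x ∷_) (comb m xs)) ys∈
... | inj₂ p = comb⇒Unique (suc m) xs u p
... | inj₁ p with ∈-map⁻ (x ∷_) p
... | zs , zs∈ , refl = All.tabulate (λ z∈ → All.lookup x≢ (comb⇒⊆ m xs zs∈ z∈)) ∷ comb⇒Unique m xs u zs∈

comb-∃ : {A : Set} {P : A → Set} (P? : ∀ x → Dec (P x)) (m : ℕ) (xs : List A) → m ≤ ∑ xs (λ x → 𝟙 (P? x)) →
         ∃ λ ys → ys ∈ comb m xs × All P ys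
comb-∃ P? zero    xs       _ = [] , here refl , []
comb-∃ P? (suc m) (x ∷ xs) h with P? x
... | no _  = let ys , ys∈ , all = comb-∃ P? (suc m) xs h in ys , ∈-++⁺ʳ _ ys∈ , all
... | yes p = let ys , ys∈ , all = comb-∃ P? m xs (s≤s⁻¹ h) in x ∷ ys , ∈-++⁺ˡ (∈-map⁺ (x ∷_) ys∈) , p ∷ all

length-cartesianProduct : {A B : Set} (xs : List A) (ys : List B) →
                          length (cartesianProduct xs ys) ≡ length xs * length ys
length-cartesianProduct []       ys = refl
length-cartesianProduct (x ∷ xs) ys = trans (length-++ (map (_,_ x) ys))
  (cong₂ _+_ (length-map (_,_ x) ys) (length-cartesianProduct xs ys))

∑-allFin-suc : ∀ n (f : Fin (suc n) → ℕ) → ∑ (allFin (suc n)) f ≡ f zero + ∑ (allFin n) (f ∘ suc)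
∑-allFin-suc n f = cong (f zero +_) (trans (cong (λ xs → ∑ xs f) (sym (map-tabulate id suc))) (∑-map suc (allFin n) f))

-- In probabilistic terms: independent coordinates with P(Q j) ≤ (1 − 1/M)^(x j).
#coordinatewise : ∀ M n {Q : Fin n → Fin (suc M) → Set} (Q? : ∀ j a → Dec (Q j a)) (x : Fin n → ℕ) →
  (∀ j → ∑ (allFin (suc M)) (λ a → 𝟙 (Q? j a)) * suc M ^ x j ≤ suc M * M ^ x j) →
  ∑ (vecs (suc M) n) (λ u → 𝟙 (all? (λ j → Q? j (lookup u j)))) * suc M ^ ∑ (allFin n) x
    ≤ suc M ^ n * M ^ ∑ (allFin n) x
#coordinatewise M zero    Q? x h = ≤-refl
#coordinatewise M (suc n) Q? x h = begin
  ∑ (vecs (suc M) (suc n)) (λ u → 𝟙 (all? (λ j → Q? j (lookup u j)))) * suc M ^ ∑ (allFin (suc n)) x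
    ≡⟨ cong₂ _*_ (∑-vecs {suc M} {n} _) (trans (cong (suc M ^_) split) (^-distribˡ-+-* (suc M) (x zero) X)) ⟩
  ∑ (allFin (suc M)) (λ a → ∑ (vecs (suc M) n) (λ u → 𝟙 (all? (λ j → Q? j (lookup (a ∷ u) j))))) * (suc M ^ x zero * suc M ^ X)
    ≤⟨ *-monoˡ-≤ _ (∑-mono (allFin (suc M)) (λ {a} _ → ∑-mono (vecs (suc M) n) (λ {u} _ → pointwise a u))) ⟩
  ∑ (allFin (suc M)) (λ a → ∑ (vecs (suc M) n) (λ u → 𝟙 (Q? zero a) * R u)) * (suc M ^ x zero * suc M ^ X)
    ≡⟨ cong (_* (suc M ^ x zero * suc M ^ X)) (trans
         (∑-cong (allFin (suc M)) (λ a → ∑-*ˡ (vecs (suc M) n) (𝟙 (Q? zero a)) R)) (∑-*ʳ (allFin (suc M)) (λ a → 𝟙 (Q? zero a)) (∑ (vecs (suc M) n) R))) ⟩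
  q * r * (suc M ^ x zero * suc M ^ X)
    ≡⟨ rearrange q r (suc M ^ x zero) (suc M ^ X) ⟩
  (q * suc M ^ x zero) * (r * suc M ^ X)
    ≤⟨ *-mono-≤ (h zero) (#coordinatewise M n (Q? ∘ suc) (x ∘ suc) (h ∘ suc)) ⟩
  (suc M * M ^ x zero) * (suc M ^ n * M ^ X)
    ≡⟨ rearrange (suc M) (M ^ x zero) (suc M ^ n) (M ^ X) ⟩
  (suc M * suc M ^ n) * (M ^ x zero * M ^ X)
    ≡⟨ cong (suc M ^ suc n *_) (trans (cong (M ^_) split) (^-distribˡ-+-* M (x zero) X)) ⟨
  suc M ^ suc n * M ^ ∑ (allFin (suc n)) x
    ∎
  where
  open ≤-Reasoning
  X = ∑ (allFin n) (x ∘ suc)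
  split : ∑ (allFin (suc n)) x ≡ x zero + X
  split = ∑-allFin-suc n x
  R : Vec (Fin (suc M)) n → ℕ
  R u = 𝟙 (all? (λ j → Q? (suc j) (lookup u j)))
  q = ∑ (allFin (suc M)) (λ a → 𝟙 (Q? zero a))
  r = ∑ (vecs (suc M) n) R
  pointwise : ∀ a u → 𝟙 (all? (λ j → Q? j (lookup (a ∷ u) j))) ≤ 𝟙 (Q? zero a) * R u
  pointwise a u = 𝟙-≤ (all? (λ j → Q? j (lookup (a ∷ u) j))) λ all → ≤-reflexive (sym (cong₂ _*_
    (𝟙-true (Q? zero a) (all zero)) (𝟙-true (all? (λ j → Q? (suc j) (lookup u j))) (all ∘ suc))))
  rearrange : ∀ a b c d → a * b * (c * d) ≡ (a * c) * (b * d)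
  rearrange = solve-∀

-- Bernoulli's inequality 1 - x/(M + 1) ≤ (1 - 1/(M + 1))^x with denominators cleared; `y` stands
-- for at most M + 1 - x, which avoids truncated subtraction.
bernoulli-minus : ∀ M x y → y + x ≤ suc M → y * suc M ^ x ≤ suc M * M ^ x
bernoulli-minus M zero    y h = *-monoˡ-≤ 1 (≤-trans (m≤m+n y 0) h)
bernoulli-minus M (suc x) y h = begin
  y * (suc M * suc M ^ x)           ≡⟨ r₁ y M (suc M ^ x) ⟩
  (y * M + y) * suc M ^ x           ≤⟨ *-monoˡ-≤ (suc M ^ x) (+-monoʳ-≤ (y * M) y≤M) ⟩
  (y * M + M) * suc M ^ x           ≡⟨ r₂ y M (suc M ^ x) ⟩
  M * (suc y * suc M ^ x)           ≤⟨ *-monoʳ-≤ M (bernoulli-minus M x (suc y) (≤-trans (≤-reflexive (sym (+-suc y x))) h)) ⟩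
  M * (suc M * M ^ x)               ≡⟨ r₃ M (M ^ x) ⟩
  suc M * (M * M ^ x)               ∎
  where
  open ≤-Reasoning
  y≤M : y ≤ M
  y≤M = s≤s⁻¹ (≤-trans (≤-trans (s≤s (m≤m+n y x)) (≤-reflexive (sym (+-suc y x)))) h)
  r₁ : ∀ y M z → y * (suc M * z) ≡ (y * M + y) * z
  r₁ = solve-∀
  r₂ : ∀ y M z → (y * M + M) * z ≡ M * (suc y * z)
  r₂ = solve-∀
  r₃ : ∀ M z → M * (suc M * z) ≡ suc M * (M * z)
  r₃ = solve-∀

-- Cells of the grid and the probability that they are empty

Cell : Set
Cell = ℕ × ℕ

-- Column c of the grid consists of the positions i with ⌊i / w⌋ = c; row r of the values coloured r.
Avoids : ∀ {M} → ℕ → Fin M → Cell → Set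
Avoids c a (c′ , r) = c′ ≡ c → ¬ toℕ a ≡ r

avoids? : ∀ {M} c (a : Fin M) A → Dec (Avoids c a A)
avoids? c a (c′ , r) = (c′ ≟ c) →-dec ¬? (toℕ a ≟ r)

allAvoids? : ∀ {M} c (a : Fin M) As → Dec (All (Avoids c a) As)
allAvoids? c a = All.all? (avoids? c a)

#inColumn : ℕ → List Cell → ℕ
#inColumn c As = ∑ As (λ A → 𝟙 (proj₁ A ≟ c))

-- Distinct cells in column `c` lie in distinct rows, so each of them excludes a colour of its own.
#avoiding : ∀ M c (As : List Cell) → Unique As → All (λ A → proj₂ A < M) As →
            ∑ (allFin M) (λ a → 𝟙 (allAvoids? c a As)) + #inColumn c As ≤ M
#avoiding M c [] _ _ = begin
  ∑ (allFin M) (λ a → 𝟙 (allAvoids? c a [])) + 0   ≡⟨ +-identityʳ _ ⟩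
  ∑ (allFin M) (λ a → 𝟙 (allAvoids? c a []))       ≤⟨ ∑-bound (allFin M) (λ {a} _ → 𝟙≤1 (allAvoids? c a [])) ⟩
  length (allFin M) * 1                            ≡⟨ trans (*-identityʳ _) (length-allFin M) ⟩
  M                                                ∎
  where open ≤-Reasoning
#avoiding M c ((c′ , r) ∷ As) (A∉ ∷ u) (r<M ∷ rs) = go (c′ ≟ c)
  where
  open ≤-Reasoning
  both rest : ℕ
  both = ∑ (allFin M) (λ a → 𝟙 (allAvoids? c a ((c′ , r) ∷ As)))
  rest = ∑ (allFin M) (λ a → 𝟙 (allAvoids? c a As))
  a₀ : Fin M
  a₀ = fromℕ< r<M
  pointwise : c′ ≡ c → ∀ a → 𝟙 (toℕ a ≟ r) + 𝟙 (allAvoids? c a ((c′ , r) ∷ As)) ≤ 𝟙 (allAvoids? c a As)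
  pointwise c′≡c a = case (toℕ a ≟ r)
    where
    case : (d : Dec (toℕ a ≡ r)) → 𝟙 d + 𝟙 (allAvoids? c a ((c′ , r) ∷ As)) ≤ 𝟙 (allAvoids? c a As)
    case (no _)    = 𝟙-mono (allAvoids? c a ((c′ , r) ∷ As)) (allAvoids? c a As) All.tail
    case (yes a≡r) = ≤-reflexive (trans
      (cong suc (n≤0⇒n≡0 (𝟙-≤ (allAvoids? c a ((c′ , r) ∷ As)) (λ all → contradiction a≡r (All.head all c′≡c)))))
      -- The colour `r` excluded by the new cell is not excluded by `As`, for that would repeat the
      -- cell.
      (sym (𝟙-true (allAvoids? c a As) (All.tabulate λ A∈ c≡ a≡ →
        All.lookup A∉ A∈ (cong₂ _,_ (trans c′≡c (sym c≡)) (trans (sym a≡r) a≡))))))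
  drop-one : c′ ≡ c → suc both ≤ rest
  drop-one c′≡c = begin
    1 + both
      ≡⟨ cong (_+ both) (𝟙-true (toℕ a₀ ≟ r) (toℕ-fromℕ< r<M)) ⟨
    𝟙 (toℕ a₀ ≟ r) + both
      ≤⟨ +-monoˡ-≤ both (f≤∑ (λ a → 𝟙 (toℕ a ≟ r)) (∈-allFin a₀)) ⟩
    ∑ (allFin M) (λ a → 𝟙 (toℕ a ≟ r)) + both
      ≡⟨ ∑-distrib-+ (allFin M) (λ a → 𝟙 (toℕ a ≟ r)) (λ a → 𝟙 (allAvoids? c a ((c′ , r) ∷ As))) ⟨
    ∑ (allFin M) (λ a → 𝟙 (toℕ a ≟ r) + 𝟙 (allAvoids? c a ((c′ , r) ∷ As)))
      ≤⟨ ∑-mono (allFin M) (λ {a} _ → pointwise c′≡c a) ⟩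
    rest
      ∎
  go : (d : Dec (c′ ≡ c)) → both + (𝟙 d + #inColumn c As) ≤ M
  go (no _) = ≤-trans (+-monoˡ-≤ (#inColumn c As) (∑-mono (allFin M) (λ {a} _ →
    𝟙-mono (allAvoids? c a ((c′ , r) ∷ As)) (allAvoids? c a As) All.tail))) (#avoiding M c As u rs)
  go (yes c′≡c) = begin
    both + suc (#inColumn c As)    ≡⟨ +-suc both (#inColumn c As) ⟩
    suc both + #inColumn c As      ≤⟨ +-monoˡ-≤ (#inColumn c As) (drop-one c′≡c) ⟩
    rest + #inColumn c As          ≤⟨ #avoiding M c As u rs ⟩
    M                              ∎

-- Positions from `suc M * w` on fall into columns of index at least `suc M`, outside all cells
-- considered.
module Grid (M n w : ℕ) .{{_ : NonZero w}} (Mw≤n : suc M * w ≤ n) where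

  column : Fin n → ℕ
  column i = toℕ i / w

  Empty : (Fin n → Fin (suc M)) → Cell → Set
  Empty v A = ∀ i → Avoids (column i) (v i) A

  empty? : ∀ v A → Dec (Empty v A)
  empty? v A = all? (λ i → avoids? (column i) (v i) A)

  -- Counted by values `j` instead of positions, since the random colours in `#empty` belong to the
  -- values; `σ ⟨$⟩ˡ j` is the position of the value `j`.
  column-size : ∀ (σ : Permutation′ n) {c} → c < suc M → w ≤ ∑ (allFin n) (λ j → 𝟙 (c ≟ column (σ ⟨$⟩ˡ j)))
  column-size σ {c} c<M = ≤count (λ j → c ≟ column (σ ⟨$⟩ˡ j)) (λ y → σ ⟨$⟩ʳ position y) injective inColumn
    where
    position< : ∀ (y : Fin w) → toℕ y + c * w < n
    position< y = begin-strict
      toℕ y + c * w    <⟨ +-monoˡ-< (c * w) (toℕ<n y) ⟩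
      suc c * w        ≤⟨ *-monoˡ-≤ w c<M ⟩
      suc M * w        ≤⟨ Mw≤n ⟩
      n                ∎
      where open ≤-Reasoning
    position : Fin w → Fin n
    position y = fromℕ< (position< y)
    injective : ∀ {x y} → σ ⟨$⟩ʳ position x ≡ σ ⟨$⟩ʳ position y → x ≡ y
    injective {x} {y} eq = toℕ-injective (+-cancelʳ-≡ (c * w) _ _ (trans (sym (toℕ-fromℕ< (position< x)))
      (trans (cong toℕ (trans (sym (Perm.inverseˡ σ)) (trans (cong (σ ⟨$⟩ˡ_) eq) (Perm.inverseˡ σ)))) (toℕ-fromℕ< (position< y)))))
    inColumn : ∀ y → c ≡ column (σ ⟨$⟩ˡ (σ ⟨$⟩ʳ position y))
    inColumn y = sym (begin
      toℕ (σ ⟨$⟩ˡ (σ ⟨$⟩ʳ position y)) / w   ≡⟨ cong (λ i → toℕ i / w) (Perm.inverseˡ σ) ⟩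
      toℕ (position y) / w                   ≡⟨ cong (_/ w) (toℕ-fromℕ< (position< y)) ⟩
      (toℕ y + c * w) / w                    ≡⟨ +-distrib-/-∣ʳ (toℕ y) (n∣m*n c) ⟩
      toℕ y / w + c * w / w                  ≡⟨ cong₂ _+_ (m<n⇒m/n≡0 (toℕ<n y)) (m*n/n≡m c w) ⟩
      c                                      ∎)
      where open ≡-Reasoning

  -- The colours of the values are independent. The value `j` must avoid the `x j` rows that `As`
  -- has in its column, with probability at most (1 - 1/(M + 1))^(x j). Each cell is counted by at
  -- least `w` values, so the exponents add up to at least `length As * w`.
  #empty : ∀ (σ : Permutation′ n) (As : List Cell) → Unique As → All (λ A → proj₁ A < suc M × proj₂ A < suc M) As →
    ∑ (vecs (suc M) n) (λ u → 𝟙 (All.all? (empty? (lookup u ∘ (σ ⟨$⟩ʳ_))) As)) * suc M ^ (length As * w)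
      ≤ suc M ^ n * M ^ (length As * w)
  #empty σ As unique bounded with m≤n⇒∃[o]m+o≡n lw≤X
    where
    x : Fin n → ℕ
    x j = #inColumn (column (σ ⟨$⟩ˡ j)) As
    lw≤X : length As * w ≤ ∑ (allFin n) x
    lw≤X = begin
      length As * w                                                           ≡⟨ ∑-const As w ⟨
      ∑ As (λ _ → w)                                                          ≤⟨ ∑-mono As (λ A∈ → column-size σ (proj₁ (All.lookup bounded A∈))) ⟩
      ∑ As (λ A → ∑ (allFin n) (λ j → 𝟙 (proj₁ A ≟ column (σ ⟨$⟩ˡ j))))       ≡⟨ ∑-swap As (allFin n) _ ⟩
      ∑ (allFin n) x                                                          ∎
      where open ≤-Reasoning
  -- `d` is the excess of the true exponent `∑ (allFin n) x` over `length As * w`; it is given away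
  -- by `M ^ d ≤ suc M ^ d`.
  ... | d , X≡ = *-cancelʳ-≤ _ _ (suc M ^ d) {{m^n≢0 (suc M) d}} (begin
    E * suc M ^ l * suc M ^ d                     ≡⟨ *-assoc E (suc M ^ l) (suc M ^ d) ⟩
    E * (suc M ^ l * suc M ^ d)                   ≡⟨ cong (E *_) (^-distribˡ-+-* (suc M) l d) ⟨
    E * suc M ^ (l + d)                           ≡⟨ cong (λ y → E * suc M ^ y) X≡ ⟩
    E * suc M ^ ∑ (allFin n) x                    ≤⟨ *-monoˡ-≤ (suc M ^ ∑ (allFin n) x) (∑-mono (vecs (suc M) n) (λ {u} _ → pointwise u)) ⟩
    ∑ (vecs (suc M) n) (λ u → 𝟙 (all? (λ j → Q? j (lookup u j)))) * suc M ^ ∑ (allFin n) x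
      ≤⟨ #coordinatewise M n Q? x (λ j → bernoulli-minus M (x j) _ (#avoiding (suc M) (column (σ ⟨$⟩ˡ j)) As unique (All.map proj₂ bounded))) ⟩
    suc M ^ n * M ^ ∑ (allFin n) x                ≡⟨ cong (λ y → suc M ^ n * M ^ y) X≡ ⟨
    suc M ^ n * M ^ (l + d)                       ≡⟨ cong (suc M ^ n *_) (^-distribˡ-+-* M l d) ⟩
    suc M ^ n * (M ^ l * M ^ d)                   ≡⟨ *-assoc (suc M ^ n) (M ^ l) (M ^ d) ⟨
    suc M ^ n * M ^ l * M ^ d                     ≤⟨ *-monoʳ-≤ (suc M ^ n * M ^ l) (^-monoˡ-≤ d (n≤1+n M)) ⟩
    suc M ^ n * M ^ l * suc M ^ d                 ∎)
    where
    open ≤-Reasoning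
    l = length As * w
    x : Fin n → ℕ
    x j = #inColumn (column (σ ⟨$⟩ˡ j)) As
    E = ∑ (vecs (suc M) n) (λ u → 𝟙 (All.all? (empty? (lookup u ∘ (σ ⟨$⟩ʳ_))) As))
    Q? : ∀ j a → Dec (All (Avoids (column (σ ⟨$⟩ˡ j)) a) As)
    Q? j a = allAvoids? (column (σ ⟨$⟩ˡ j)) a As
    pointwise : ∀ u → 𝟙 (All.all? (empty? (lookup u ∘ (σ ⟨$⟩ʳ_))) As) ≤ 𝟙 (all? (λ j → Q? j (lookup u j)))
    pointwise u = 𝟙-mono (All.all? (empty? (lookup u ∘ (σ ⟨$⟩ʳ_))) As) (all? (λ j → Q? j (lookup u j)))
      λ all j → All.map (λ {A} empty → subst (λ y → Avoids (column (σ ⟨$⟩ˡ j)) (lookup u y) A) (Perm.inverseʳ σ) (empty (σ ⟨$⟩ˡ j))) all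

  module Boxes {k : ℕ} (corner : Fin k → ℕ) (b m : ℕ) (corner≤ : ∀ j → corner j + b ≤ suc M) where

    box : Fin k → Fin k → List Cell
    box j i = map (λ (s , t) → corner j + toℕ s , corner i + toℕ t) (cartesianProduct (allFin b) (allFin b))

    box-unique : ∀ j i → Unique (box j i)
    box-unique j i = map⁺ (λ eq → cong₂ _,_
        (toℕ-injective (+-cancelˡ-≡ (corner j) _ _ (cong proj₁ eq)))
        (toℕ-injective (+-cancelˡ-≡ (corner i) _ _ (cong proj₂ eq))))
      (cartesianProduct⁺ (allFin⁺ b) (allFin⁺ b))

    box-bounded : ∀ j i {A} → A ∈ box j i → proj₁ A < suc M × proj₂ A < suc M
    box-bounded j i A∈ with ∈-map⁻ _ A∈
    ... | (s , t) , _ , refl = bound j s , bound i t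
      where
      bound : ∀ j s → corner j + toℕ s < suc M
      bound j s = <-≤-trans (+-monoʳ-< (corner j) (toℕ<n s)) (corner≤ j)

    length-box : ∀ j i → length (box j i) ≡ b * b
    length-box j i = begin
      length (box j i)                                     ≡⟨ length-map _ (cartesianProduct (allFin b) (allFin b)) ⟩
      length (cartesianProduct (allFin b) (allFin b))      ≡⟨ length-cartesianProduct (allFin b) (allFin b) ⟩
      length (allFin b) * length (allFin b)                ≡⟨ cong₂ _*_ (length-allFin b) (length-allFin b) ⟩
      b * b                                                ∎
      where open ≡-Reasoning

    -- The boxes of all pairs `(j , i)` enter, not only those of the pairs `(j , π j)` of one
    -- pattern. So the union bound runs over `k * k` boxes, and one colouring without empty `m`-sets
    -- serves all `k !` patterns.
    #emptySets : (Fin n → Fin (suc M)) → ℕ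
    #emptySets v = ∑ (allFin k) (λ j → ∑ (allFin k) (λ i → ∑ (comb m (box j i)) (λ As → 𝟙 (All.all? (empty? v) As))))

    few-empty : ∀ v → #emptySets v ≡ 0 → ∀ j i →
      ∑ (allFin b) (λ s → ∑ (allFin b) (λ t → 𝟙 (empty? v (corner j + toℕ s , corner i + toℕ t)))) < m
    few-empty v none j i = ≰⇒> λ m≤ →
      let As , As∈ , all = comb-∃ (empty? v) m (box j i) (≤-trans m≤ (≤-reflexive (sym box-sum)))
      in 𝟙≡0⇒¬ (All.all? (empty? v) As) (∑≡0⇒≡0 (∑≡0⇒≡0 (∑≡0⇒≡0 none (∈-allFin j)) (∈-allFin i)) As∈) all
      where
      box-sum : ∑ (box j i) (λ A → 𝟙 (empty? v A)) ≡
                ∑ (allFin b) (λ s → ∑ (allFin b) (λ t → 𝟙 (empty? v (corner j + toℕ s , corner i + toℕ t))))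
      box-sum = trans (∑-map _ (cartesianProduct (allFin b) (allFin b)) _) (∑-cartesianProduct (allFin b) (allFin b) _)

    -- By `#empty` and the hypothesis on `D`, `m` given cells are all empty with probability at most
    -- `1 / D`; there are `k * k` boxes with at most `(b * b) ^ m` sets of `m` cells each.
    expected-emptySets : ∀ D → D * M ^ (m * w) ≤ suc M ^ (m * w) → (σ : Permutation′ n) →
      ∑ (vecs (suc M) n) (λ u → #emptySets (lookup u ∘ (σ ⟨$⟩ʳ_))) * D ≤ k * (k * ((b * b) ^ m * suc M ^ n))
    expected-emptySets D D≤ σ = begin
      ∑ (vecs (suc M) n) (λ u → #emptySets (v u)) * D
        ≡⟨ cong (_* D) (∑-swap (vecs (suc M) n) (allFin k) _) ⟩
      ∑ (allFin k) (λ j → ∑ (vecs (suc M) n) (λ u → ∑ (allFin k) (λ i → S j i u))) * D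
        ≡⟨ cong (_* D) (∑-cong (allFin k) (λ j → ∑-swap (vecs (suc M) n) (allFin k) _)) ⟩
      ∑ (allFin k) (λ j → ∑ (allFin k) (λ i → ∑ (vecs (suc M) n) (S j i))) * D
        ≡⟨ ∑-*ʳ (allFin k) _ D ⟨
      ∑ (allFin k) (λ j → ∑ (allFin k) (λ i → ∑ (vecs (suc M) n) (S j i)) * D)
        ≡⟨ ∑-cong (allFin k) (λ j → sym (∑-*ʳ (allFin k) _ D)) ⟩
      ∑ (allFin k) (λ j → ∑ (allFin k) (λ i → ∑ (vecs (suc M) n) (S j i) * D))
        ≤⟨ ∑-bound (allFin k) (λ {j} _ → ∑-bound (allFin k) (λ {i} _ → perBox j i)) ⟩
      length (allFin k) * (length (allFin k) * ((b * b) ^ m * suc M ^ n))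
        ≡⟨ cong (λ l → l * (l * ((b * b) ^ m * suc M ^ n))) (length-allFin k) ⟩
      k * (k * ((b * b) ^ m * suc M ^ n))
        ∎
      where
      open ≤-Reasoning
      v : Vec (Fin (suc M)) n → Fin n → Fin (suc M)
      v u = lookup u ∘ (σ ⟨$⟩ʳ_)
      S : Fin k → Fin k → Vec (Fin (suc M)) n → ℕ
      S j i u = ∑ (comb m (box j i)) (λ As → 𝟙 (All.all? (empty? (v u)) As))
      perSet : ∀ j i {As} → As ∈ comb m (box j i) →
               ∑ (vecs (suc M) n) (λ u → 𝟙 (All.all? (empty? (v u)) As)) * D ≤ suc M ^ n
      perSet j i {As} As∈ = *-cancelʳ-≤ _ _ (suc M ^ (m * w)) {{m^n≢0 (suc M) (m * w)}} (begin
        E * D * suc M ^ (m * w)             ≡⟨ swap E D (suc M ^ (m * w)) ⟩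
        D * (E * suc M ^ (m * w))           ≤⟨ *-monoʳ-≤ D (subst (λ l → E * suc M ^ (l * w) ≤ suc M ^ n * M ^ (l * w)) (comb⇒length m (box j i) As∈)
                                                 (#empty σ As (comb⇒Unique m (box j i) (box-unique j i) As∈)
                                                   (All.tabulate (λ A∈ → box-bounded j i (comb⇒⊆ m (box j i) As∈ A∈))))) ⟩
        D * (suc M ^ n * M ^ (m * w))       ≡⟨ swap′ D (suc M ^ n) (M ^ (m * w)) ⟩
        suc M ^ n * (D * M ^ (m * w))       ≤⟨ *-monoʳ-≤ (suc M ^ n) D≤ ⟩
        suc M ^ n * suc M ^ (m * w)         ∎)
        where
        E = ∑ (vecs (suc M) n) (λ u → 𝟙 (All.all? (empty? (v u)) As))
        swap : ∀ a b c → a * b * c ≡ b * (a * c)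
        swap = solve-∀
        swap′ : ∀ a b c → a * (b * c) ≡ b * (a * c)
        swap′ = solve-∀
      perBox : ∀ j i → ∑ (vecs (suc M) n) (S j i) * D ≤ (b * b) ^ m * suc M ^ n
      perBox j i = begin
        ∑ (vecs (suc M) n) (S j i) * D
          ≡⟨ cong (_* D) (∑-swap (vecs (suc M) n) (comb m (box j i)) _) ⟩
        ∑ (comb m (box j i)) (λ As → ∑ (vecs (suc M) n) (λ u → 𝟙 (All.all? (empty? (v u)) As))) * D
          ≡⟨ ∑-*ʳ (comb m (box j i)) _ D ⟨
        ∑ (comb m (box j i)) (λ As → ∑ (vecs (suc M) n) (λ u → 𝟙 (All.all? (empty? (v u)) As)) * D)
          ≤⟨ ∑-bound (comb m (box j i)) (perSet j i) ⟩
        length (comb m (box j i)) * suc M ^ n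
          ≤⟨ *-monoˡ-≤ (suc M ^ n) (≤-trans (length-comb m (box j i)) (≤-reflexive (cong (_^ m) (length-box j i)))) ⟩
        (b * b) ^ m * suc M ^ n
          ∎

-- Embedding a pattern

divMod-injective : ∀ {i j} b .{{_ : NonZero b}} → i / b ≡ j / b → i % b ≡ j % b → i ≡ j
divMod-injective {i} {j} b eq/ eq% = begin
  i                    ≡⟨ m≡m%n+[m/n]*n i b ⟩
  i % b + i / b * b    ≡⟨ cong₂ (λ r q → r + q * b) eq% eq/ ⟩
  j % b + j / b * b    ≡⟨ m≡m%n+[m/n]*n j b ⟨
  j                    ∎
  where open ≡-Reasoning

↑ˡ≢↑ʳ : ∀ {B} (x y : Fin B) → ¬ x ↑ˡ B ≡ B ↑ʳ y
↑ˡ≢↑ʳ {B} x y eq = <⇒≢ (≤-trans (toℕ<n x) (m≤m+n B (toℕ y)))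
  (trans (sym (Fin.toℕ-↑ˡ x B)) (trans (cong toℕ eq) (Fin.toℕ-↑ʳ B y)))

-- Block ⌊i / b⌋ owns the 2b consecutive lines from 2b⌊i / b⌋ on, and shift moves its b lines inside them.
line : ∀ b .{{_ : NonZero b}} → ℕ → ℕ
line b i = 2 * b * (i / b) + i % b

-- Within a block both lines get the same shift. Across blocks, `i % b` and the shift are both below
-- `b`, so a line stays among the `2 * b` lines of its block.
shifted-line-mono : ∀ {b} .{{_ : NonZero b}} (shift : ℕ → ℕ) → (∀ x → shift x < b) → ∀ {i j} → i < j →
                    line b i + shift (i / b) < line b j + shift (j / b)
shifted-line-mono {b} shift shift< {i} {j} i<j with <-cmp (i / b) (j / b)
... | tri> _ _ i/b>j/b = contradiction (/-monoˡ-≤ b (<⇒≤ i<j)) (<⇒≱ i/b>j/b)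
... | tri≈ _ eq _ rewrite eq = +-monoˡ-< (shift (j / b)) (+-monoʳ-< (2 * b * (j / b))
        (+-cancelʳ-< (j / b * b) (i % b) (j % b)
          (subst₂ _<_ (trans (m≡m%n+[m/n]*n i b) (cong (λ q → i % b + q * b) eq)) (m≡m%n+[m/n]*n j b) i<j)))
... | tri< i/b<j/b _ _ = begin-strict
  2 * b * (i / b) + i % b + shift (i / b)   <⟨ +-mono-≤-< (+-monoʳ-≤ (2 * b * (i / b)) (<⇒≤ (m%n<n i b))) (shift< (i / b)) ⟩
  2 * b * (i / b) + b + b                   ≡⟨ r b (i / b) ⟩
  2 * b * suc (i / b)                       ≤⟨ *-monoʳ-≤ (2 * b) i/b<j/b ⟩
  2 * b * (j / b)                           ≤⟨ m≤m+n _ (j % b + shift (j / b)) ⟩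
  2 * b * (j / b) + (j % b + shift (j / b)) ≡⟨ +-assoc (2 * b * (j / b)) (j % b) (shift (j / b)) ⟨
  2 * b * (j / b) + j % b + shift (j / b)   ∎
  where
  open ≤-Reasoning
  r : ∀ b x → 2 * b * x + b + b ≡ 2 * b * suc x
  r = solve-∀

module Embed (M n w : ℕ) .{{_ : NonZero w}} (Mw≤n : suc M * w ≤ n) (k b m B : ℕ) .{{_ : NonZero b}}
             (8bm≤bb : 4 * ((b + b) * m) ≤ b * b) (k≤ : k ≤ B * b)
             (line≤ : ∀ (j : Fin k) → line b (toℕ j) + b ≤ suc M) where

  open Grid M n w Mw≤n
  open Boxes {k} (line b ∘ toℕ) b m line≤ public

  block : Fin k → Fin B
  block j = fromℕ< (m<n*o⇒m/o<n (<-≤-trans (toℕ<n j) k≤))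

  toℕ-block : ∀ j → toℕ (block j) ≡ toℕ j / b
  toℕ-block j = toℕ-fromℕ< _

  offset : Fin k → Fin b
  offset j = fromℕ< (m%n<n (toℕ j) b)

  block-offset-injective : ∀ {i j} → block i ≡ block j → offset i ≡ offset j → i ≡ j
  block-offset-injective eq/ eq% = toℕ-injective
    (divMod-injective b (fromℕ<-injective _ _ _ _ eq/) (fromℕ<-injective _ _ _ _ eq%))

  nonempty : ∀ v A → ¬ Empty v A → ∃ λ i → column i ≡ proj₁ A × toℕ (v i) ≡ proj₂ A
  nonempty v (c , r) ¬empty with ¬∀⟶∃¬ n _ (λ i → avoids? (column i) (v i) (c , r)) ¬empty
  ... | i , ¬avoids with c ≟ column i | toℕ (v i) ≟ r
  ... | yes c≡ | yes r≡ = i , sym c≡ , r≡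
  ... | no c≢  | _      = contradiction (λ c≡ → contradiction c≡ c≢) ¬avoids
  ... | yes _  | no r≢  = contradiction (λ _ → r≢) ¬avoids

  module _ (v : Fin n → Fin (suc M)) (none : #emptySets v ≡ 0) (π : Permutation′ k) where

    -- A bipartite graph: the `B` column blocks are followed by the `B` row blocks, so the two kinds
    -- of shift are chosen independently. Constraint `j` joins the column block of the index `j` to
    -- the row block of its value under `π`.
    p q : Fin k → Fin (B + B)
    p j = block j ↑ˡ B
    q j = B ↑ʳ block (π ⟨$⟩ʳ j)

    cell : Fin k → Fin b → Fin b → Cell
    cell j s t = line b (toℕ j) + toℕ s , line b (toℕ (π ⟨$⟩ʳ j)) + toℕ t

    open LocalLemma p q (λ j s t → Empty v (cell j s t)) (λ j s t → empty? v (cell j s t)) using (solution)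

    -- Constraints with the same column block differ in the offset of `j`, those with the same row
    -- block in the offset of `π ⟨$⟩ʳ j`; each kind contributes at most `b`.
    degree≤ : ∀ x → ∑ (allFin k) (λ j → 𝟙 ((p j Fin.≟ x) ⊎-dec (q j Fin.≟ x))) ≤ b + b
    degree≤ x = begin
      ∑ (allFin k) (λ j → 𝟙 ((p j Fin.≟ x) ⊎-dec (q j Fin.≟ x)))
        ≤⟨ ∑-mono (allFin k) (λ {j} _ → 𝟙-⊎ (p j Fin.≟ x) (q j Fin.≟ x)) ⟩
      ∑ (allFin k) (λ j → 𝟙 (p j Fin.≟ x) + 𝟙 (q j Fin.≟ x))
        ≡⟨ ∑-distrib-+ (allFin k) _ _ ⟩
      ∑ (allFin k) (λ j → 𝟙 (p j Fin.≟ x)) + ∑ (allFin k) (λ j → 𝟙 (q j Fin.≟ x))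
        ≤⟨ +-mono-≤
             (count≤ (λ j → p j Fin.≟ x) offset
               (λ eq eq′ → block-offset-injective (↑ˡ-injective B _ _ (trans eq (sym eq′)))))
             (count≤ (λ j → q j Fin.≟ x) (offset ∘ (π ⟨$⟩ʳ_))
               (λ eq eq′ eq% → π-injective (block-offset-injective (↑ʳ-injective B _ _ (trans eq (sym eq′))) eq%))) ⟩
      b + b ∎
      where
      open ≤-Reasoning
      𝟙-⊎ : {P Q : Set} (P? : Dec P) (Q? : Dec Q) → 𝟙 (P? ⊎-dec Q?) ≤ 𝟙 P? + 𝟙 Q?
      𝟙-⊎ (yes _) Q?      = s≤s z≤n
      𝟙-⊎ (no _)  (yes _) = ≤-refl
      𝟙-⊎ (no _)  (no _)  = ≤-refl
      π-injective : ∀ {i j} → π ⟨$⟩ʳ i ≡ π ⟨$⟩ʳ j → i ≡ j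
      π-injective eq = trans (sym (Perm.inverseˡ π)) (trans (cong (π ⟨$⟩ˡ_) eq) (Perm.inverseˡ π))

    -- The local lemma with `T = b`, where `8bm≤bb` is its numerical condition and `few-empty`
    -- bounds the bad pairs of shifts.
    shifts : ∃ λ f → ∀ j → ¬ Empty v (cell j (lookup f (p j)) (lookup f (q j)))
    shifts = solution {D = b + b} {c = m} (λ j → ↑ˡ≢↑ʳ (block j) (block (π ⟨$⟩ʳ j)))
      (λ j → <⇒≤ (few-empty v none j (π ⟨$⟩ʳ j))) degree≤ 8bm≤bb (>-nonZero⁻¹ b)

    -- Turns shifts into a function on all of `ℕ`, as `shifted-line-mono` expects. Blocks from `B`
    -- on get the shift 0, which is below `b`.
    extend : (Fin B → Fin b) → ℕ → ℕ
    extend f x with x <? B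
    ... | yes x<B = toℕ (f (fromℕ< x<B))
    ... | no _    = 0

    extend< : ∀ f x → extend f x < b
    extend< f x with x <? B
    ... | yes _ = toℕ<n _
    ... | no _  = >-nonZero⁻¹ b

    extend-block : ∀ f j → extend f (toℕ j / b) ≡ toℕ (f (block j))
    extend-block f j with toℕ j / b <? B
    ... | yes _   = refl
    ... | no j/b≮ = contradiction (subst (_< B) (toℕ-block j) (toℕ<n (block j))) j/b≮

    -- The column is a monotone function of the position, and `z` is one of the value; so strictly
    -- increasing columns and rows force strictly increasing positions and values.
    embedding : (colShift rowShift : Fin B → Fin b)
                (point : ∀ j → ∃ λ i → column i ≡ line b (toℕ j) + toℕ (colShift (block j)) ×
                                       toℕ (v i) ≡ line b (toℕ (π ⟨$⟩ʳ j)) + toℕ (rowShift (block (π ⟨$⟩ʳ j)))) →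
                ∀ z → Monotone z → (σ : Permutation′ n) → (∀ i → v i ≡ z (σ ⟨$⟩ʳ i)) → Contains σ π
    embedding colShift rowShift point z mono σ v≡ = x , x-mono , λ i j → mk⇔ (σx-reflects i j) (σx-mono i j)
      where
      x : Fin k → Fin n
      x j = proj₁ (point j)
      place-mono : ∀ f {i j} → i Fin.< j → line b (toℕ i) + toℕ (f (block i)) < line b (toℕ j) + toℕ (f (block j))
      place-mono f {i} {j} i<j = subst₂ (λ s t → line b (toℕ i) + s < line b (toℕ j) + t)
        (extend-block f i) (extend-block f j) (shifted-line-mono (extend f) (extend< f) i<j)
      x-mono : ∀ i j → i Fin.< j → x i Fin.< x j
      x-mono i j i<j = ≰⇒> λ xj≤xi → <⇒≱ (subst₂ _<_ (sym (proj₁ (proj₂ (point i)))) (sym (proj₁ (proj₂ (point j))))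
        (place-mono colShift i<j)) (/-monoˡ-≤ w xj≤xi)
      σx-mono : ∀ i j → (π ⟨$⟩ʳ i) Fin.< (π ⟨$⟩ʳ j) → (σ ⟨$⟩ʳ x i) Fin.< (σ ⟨$⟩ʳ x j)
      σx-mono i j πi<πj = ≰⇒> λ σxj≤σxi → <⇒≱ (subst₂ _<_ (row i) (row j) (place-mono rowShift πi<πj)) (mono _ _ σxj≤σxi)
        where
        row : ∀ j → line b (toℕ (π ⟨$⟩ʳ j)) + toℕ (rowShift (block (π ⟨$⟩ʳ j))) ≡ toℕ (z (σ ⟨$⟩ʳ x j))
        row j = trans (sym (proj₂ (proj₂ (point j)))) (cong toℕ (v≡ (x j)))
      σx-reflects : ∀ i j → (σ ⟨$⟩ʳ x i) Fin.< (σ ⟨$⟩ʳ x j) → (π ⟨$⟩ʳ i) Fin.< (π ⟨$⟩ʳ j)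
      σx-reflects i j σxi<σxj with Fin.<-cmp (π ⟨$⟩ʳ i) (π ⟨$⟩ʳ j)
      ... | tri< πi<πj _ _ = πi<πj
      ... | tri> _ _ πi>πj = contradiction (σx-mono j i πi>πj) (<⇒≯ σxi<σxj)
      ... | tri≈ _ πi≡πj _ = contradiction (cong (λ y → toℕ (σ ⟨$⟩ʳ x y)) (trans (sym (Perm.inverseˡ π))
              (trans (cong (π ⟨$⟩ˡ_) πi≡πj) (Perm.inverseˡ π)))) (<⇒≢ σxi<σxj)

    contains : ∀ z → Monotone z → (σ : Permutation′ n) → (∀ i → v i ≡ z (σ ⟨$⟩ʳ i)) → Contains σ π
    contains with shifts
    ... | f , nonEmpty = embedding (λ y → lookup f (y ↑ˡ B)) (λ y → lookup f (B ↑ʳ y))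
      (λ j → nonempty v (cell j (lookup f (p j)) (lookup f (q j))) (nonEmpty j))

-- The union bound

bernoulli-plus : ∀ M x → M ^ x * (M + x) ≤ suc M ^ x * M
bernoulli-plus M zero    = ≤-reflexive (cong (_+ 0) (+-identityʳ M))
bernoulli-plus M (suc x) = begin
  M * M ^ x * (M + suc x)            ≡⟨ r₁ M (M ^ x) x ⟩
  M ^ x * (M * (M + suc x))          ≤⟨ *-monoʳ-≤ (M ^ x) (m≤m+n _ x) ⟩
  M ^ x * (M * (M + suc x) + x)      ≡⟨ r₂ M (M ^ x) x ⟩
  suc M * (M ^ x * (M + x))          ≤⟨ *-monoʳ-≤ (suc M) (bernoulli-plus M x) ⟩
  suc M * (suc M ^ x * M)            ≡⟨ *-assoc (suc M) (suc M ^ x) M ⟨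
  suc M * suc M ^ x * M              ∎
  where
  open ≤-Reasoning
  r₁ : ∀ M z x → M * z * (M + suc x) ≡ z * (M * (M + suc x))
  r₁ = solve-∀
  r₂ : ∀ M z x → z * (M * (M + suc x) + x) ≡ suc M * (z * (M + x))
  r₂ = solve-∀

-- Bernoulli's inequality with exponent `suc M`. It says that a column of `suc M` positions misses a
-- given row with probability at most one half.
2*M^[1+M]≤[1+M]^[1+M] : ∀ M → 2 * M ^ suc M ≤ suc M ^ suc M
2*M^[1+M]≤[1+M]^[1+M] zero      = z≤n
2*M^[1+M]≤[1+M]^[1+M] M@(suc _) = *-cancelʳ-≤ _ _ M (begin
  2 * M ^ suc M * M          ≡⟨ r (M ^ suc M) M ⟩
  M ^ suc M * (M + M)        ≤⟨ *-monoʳ-≤ (M ^ suc M) (+-monoʳ-≤ M (n≤1+n M)) ⟩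
  M ^ suc M * (M + suc M)    ≤⟨ bernoulli-plus M (suc M) ⟩
  suc M ^ suc M * M          ∎)
  where
  open ≤-Reasoning
  r : ∀ z M → 2 * z * M ≡ z * (M + M)
  r = solve-∀

^-distribʳ-* : ∀ a b x → (a * b) ^ x ≡ a ^ x * b ^ x
^-distribʳ-* a b zero    = refl
^-distribʳ-* a b (suc x) = trans (cong (a * b *_) (^-distribʳ-* a b x)) (r a b (a ^ x) (b ^ x))
  where
  r : ∀ a b c d → a * b * (c * d) ≡ a * c * (b * d)
  r = solve-∀

-- The width `suc M * e` amounts to `e` groups of `suc M` positions, each of which at least halves
-- the emptiness probability; over `m` cells the bounds multiply.
emptiness-decay : ∀ M m e → (2 ^ e) ^ m * M ^ (m * (suc M * e)) ≤ suc M ^ (m * (suc M * e))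
emptiness-decay M m e = begin
  (2 ^ e) ^ m * M ^ (m * (suc M * e))       ≡⟨ cong₂ _*_ (^-*-assoc 2 e m) (trans (cong (M ^_) (r m (suc M) e)) (sym (^-*-assoc M (suc M) (e * m)))) ⟩
  2 ^ (e * m) * (M ^ suc M) ^ (e * m)       ≡⟨ ^-distribʳ-* 2 (M ^ suc M) (e * m) ⟨
  (2 * M ^ suc M) ^ (e * m)                 ≤⟨ ^-monoˡ-≤ (e * m) (2*M^[1+M]≤[1+M]^[1+M] M) ⟩
  (suc M ^ suc M) ^ (e * m)                 ≡⟨ trans (^-*-assoc (suc M) (suc M) (e * m)) (cong (suc M ^_) (sym (r m (suc M) e))) ⟩
  suc M ^ (m * (suc M * e))                 ∎
  where
  open ≤-Reasoning
  r : ∀ m M e → m * (M * e) ≡ M * (e * m)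
  r = solve-∀

-- Binary logarithms and elementary estimates

binaryLog : ∀ k → 1 ≤ k → ∃ λ m → 2 ^ m ≤ k × k < 2 ^ suc m
binaryLog (suc zero)        _ = 0 , ≤-refl , ≤-refl
binaryLog (suc k@(suc _)) _ with binaryLog k (s≤s z≤n)
... | m , lo , hi with suc k <? 2 ^ suc m
... | yes p = m , ≤-trans lo (n≤1+n k) , p
... | no ¬p = suc m , ≮⇒≥ ¬p , ≤-<-trans hi (^-monoʳ-< 2 (s≤s (s≤s z≤n)) (n<1+n (suc m)))

2^-cancel-< : ∀ {x y} → 2 ^ x < 2 ^ y → x < y
2^-cancel-< {x} {y} h = ≰⇒> λ y≤x → <⇒≱ h (^-monoʳ-≤ 2 y≤x)

n<2^n : ∀ n → n < 2 ^ n
n<2^n zero    = s≤s z≤n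
n<2^n (suc n) = begin-strict
  1 + n          <⟨ +-mono-≤-< (>-nonZero⁻¹ (2 ^ n) {{m^n≢0 2 n}}) (n<2^n n) ⟩
  2 ^ n + 2 ^ n  ≡⟨ cong (_+_ (2 ^ n)) (+-identityʳ (2 ^ n)) ⟨
  2 ^ suc n      ∎
  where open ≤-Reasoning

-- For the block length: with `b = 8 * m` and `2 ^ m ≤ k` it gives `b ≤ k`.
8*m≤2^m : ∀ i → 8 * (8 + i) ≤ 2 ^ (8 + i)
8*m≤2^m zero    = m≤m+n 64 192
8*m≤2^m (suc i) = begin
  8 * (8 + suc i)              ≡⟨ r i ⟩
  8 * (8 + i) + 8              ≤⟨ +-mono-≤ (8*m≤2^m i) (≤-trans (≤-trans (m≤m+n 8 (56 + 8 * i)) (≤-reflexive (r′ i))) (8*m≤2^m i)) ⟩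
  2 ^ (8 + i) + 2 ^ (8 + i)    ≡⟨ cong (_+_ (2 ^ (8 + i))) (+-identityʳ (2 ^ (8 + i))) ⟨
  2 ^ suc (8 + i)              ≡⟨ cong (2 ^_) (+-suc 8 i) ⟨
  2 ^ (8 + suc i)              ∎
  where
  open ≤-Reasoning
  r : ∀ i → 8 * (8 + suc i) ≡ 8 * (8 + i) + 8
  r = solve-∀
  r′ : ∀ i → 8 + (56 + 8 * i) ≡ 8 * (8 + i)
  r′ = solve-∀

m≤[1+m/n]*n : ∀ m n .{{_ : NonZero n}} → m ≤ suc (m / n) * n
m≤[1+m/n]*n m n = ≤-trans (≤-reflexive (m≡m%n+[m/n]*n m n)) (+-monoˡ-≤ (m / n * n) (<⇒≤ (m%n<n m n)))

line≤2* : ∀ b .{{_ : NonZero b}} j → line b j ≤ 2 * j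
line≤2* b j = begin
  2 * b * (j / b) + j % b               ≤⟨ m≤m+n _ (j % b) ⟩
  2 * b * (j / b) + j % b + j % b       ≡⟨ r b (j / b) (j % b) ⟩
  2 * (j % b + j / b * b)               ≡⟨ cong (2 *_) (m≡m%n+[m/n]*n j b) ⟨
  2 * j                                 ∎
  where
  open ≤-Reasoning
  r : ∀ b x y → 2 * b * x + y + y ≡ 2 * (y + x * b)
  r = solve-∀

-- `m ≤ 2 ^ suc N` makes `2 ^ (2 * N + 11)` at least `512 * (m * m)`, which is `8 * (b * b)`. So
-- emptiness beats the `(b * b) ^ m` sets by a factor `8 ^ m`, and `k * k ≤ 4 * 4 ^ m` leaves
-- `2 ^ m / 4` of it.
union-bound : ∀ {S k b m N X} .{{_ : NonZero b}} → b ≡ 8 * m → k ≤ 2 * 2 ^ m → m ≤ 2 ^ suc N →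
  S * (2 ^ (2 * N + 11)) ^ m ≤ k * (k * ((b * b) ^ m * X)) → S * 2 ^ m ≤ 4 * X
union-bound {S} {k} {_} {m} {N} {X} refl k≤ m≤ h =
  *-cancelʳ-≤ _ _ (4ᵐ * b²) {{m*n≢0 4ᵐ b² {{m*n≢0 (2 ^ m) (2 ^ m) {{m^n≢0 2 m}} {{m^n≢0 2 m}}}} {{m^n≢0 (8 * m * (8 * m)) m {{m*n≢0 (8 * m) (8 * m)}}}}}} (begin
    S * 2 ^ m * (4ᵐ * b²)                          ≡⟨ r₁ S (2 ^ m) b² ⟩
    S * (b² * (2 ^ m * (2 ^ m * 2 ^ m)))           ≡⟨ cong (λ y → S * (b² * y)) 8ᵐ ⟨
    S * (b² * 8 ^ m)                               ≡⟨ cong (S *_) (^-distribʳ-* (8 * m * (8 * m)) 8 m) ⟨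
    S * (8 * m * (8 * m) * 8) ^ m                  ≤⟨ *-monoʳ-≤ S (^-monoˡ-≤ m 512mm≤) ⟩
    S * (2 ^ (2 * N + 11)) ^ m                     ≤⟨ h ⟩
    k * (k * (b² * X))                             ≤⟨ *-mono-≤ k≤ (*-monoˡ-≤ (b² * X) k≤) ⟩
    2 * 2 ^ m * (2 * 2 ^ m * (b² * X))             ≡⟨ r₂ (2 ^ m) b² X ⟩
    4 * X * (4ᵐ * b²)                              ∎)
  where
  open ≤-Reasoning
  b² = (8 * m * (8 * m)) ^ m
  4ᵐ = 2 ^ m * 2 ^ m
  8ᵐ : 8 ^ m ≡ 2 ^ m * (2 ^ m * 2 ^ m)
  8ᵐ = trans (^-distribʳ-* 2 4 m) (cong (2 ^ m *_) (^-distribʳ-* 2 2 m))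
  512mm≤ : 8 * m * (8 * m) * 8 ≤ 2 ^ (2 * N + 11)
  512mm≤ = begin
    8 * m * (8 * m) * 8            ≡⟨ r₃ m ⟩
    512 * (m * m)                  ≤⟨ *-monoʳ-≤ 512 (*-mono-≤ m≤ m≤) ⟩
    512 * (2 ^ suc N * 2 ^ suc N)  ≡⟨ cong (512 *_) (^-distribˡ-+-* 2 (suc N) (suc N)) ⟨
    2 ^ 9 * 2 ^ (suc N + suc N)    ≡⟨ ^-distribˡ-+-* 2 9 (suc N + suc N) ⟨
    2 ^ (9 + (suc N + suc N))      ≡⟨ cong (2 ^_) (r₄ N) ⟩
    2 ^ (2 * N + 11)               ∎
    where
    r₃ : ∀ m → 8 * m * (8 * m) * 8 ≡ 512 * (m * m)
    r₃ = solve-∀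
    r₄ : ∀ N → 9 + (suc N + suc N) ≡ 2 * N + 11
    r₄ = solve-∀
  r₁ : ∀ S p y → S * p * (p * p * y) ≡ S * (y * (p * (p * p)))
  r₁ = solve-∀
  r₂ : ∀ p y X → 2 * p * (2 * p * (y * X)) ≡ 4 * X * (p * p * y)
  r₂ = solve-∀

Covered : (n k : ℕ) → List (Fin n → Fin n) → Set
Covered n k L = (σ : Permutation′ n) → ¬ Universal k σ → Any (λ τ → ∀ i → σ ⟨$⟩ʳ i ≡ τ i) L

-- The width w makes a cell empty with probability at most (1 − 1/(1 + M))^w ≤ 2^-(2N + 11) ≤ 1/(512 m²).
grid-cover : ∀ M n w k b m B N .{{_ : NonZero w}} .{{_ : NonZero b}} → w ≡ suc M * (2 * N + 11) → b ≡ 8 * m →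
  suc M * w ≤ n → k ≤ B * b → (∀ (j : Fin k) → line b (toℕ j) + b ≤ suc M) → k ≤ 2 * 2 ^ m → m ≤ 2 ^ suc N →
  ∃ λ L → length L * 2 ^ m ≤ 4 * n ! × Covered n k L
grid-cover M n w k b m B N w≡ b≡ Mw≤n k≤Bb line≤ k≤ m≤ =
  cover (Universal k) #emptySets 4 (2 ^ m) (s≤s z≤n) expected (λ z mono v σ v≡ none π → contains v none π z mono σ v≡)
  where
  -- With `b = 8 * m` the local lemma condition `4 * (D * c) ≤ T * T`, for `D = b + b`, `c = m` and
  -- `T = b`, holds with equality.
  8bm : ∀ b m → b ≡ 8 * m → 4 * ((b + b) * m) ≡ b * b
  8bm _ m refl = r m
    where
    r : ∀ m → 4 * ((8 * m + 8 * m) * m) ≡ 8 * m * (8 * m)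
    r = solve-∀
  open Embed M n w Mw≤n k b m B (≤-reflexive (8bm b m b≡)) k≤Bb line≤
  decay : (2 ^ (2 * N + 11)) ^ m * M ^ (m * w) ≤ suc M ^ (m * w)
  decay = subst (λ w → (2 ^ (2 * N + 11)) ^ m * M ^ (m * w) ≤ suc M ^ (m * w)) (sym w≡) (emptiness-decay M m (2 * N + 11))
  expected : ∀ σ → ∑ (vecs (suc M) n) (λ u → #emptySets (lookup u ∘ (σ ⟨$⟩ʳ_))) * 2 ^ m ≤ 4 * suc M ^ n
  expected σ = union-bound {∑ (vecs (suc M) n) (λ u → #emptySets (lookup u ∘ (σ ⟨$⟩ʳ_)))} {k} {b} {m} {N} b≡ k≤ m≤
    (expected-emptySets ((2 ^ (2 * N + 11)) ^ m) decay σ)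

-- Choice of the parameters

quotient : ∀ n d .{{_ : NonZero d}} → ∃ λ Q → Q * d ≤ n × n ≤ suc Q * d
quotient n d = n / d , m/n*n≤m n d , m≤[1+m/n]*n n d

-- `Q` is the integer part of `n / (1000 k²)`, about 2 log log k for the `n` of the theorem;
-- rounding up to `suc Q` gives the `N` of `ThresholdLe⇒≤`.
ThresholdLe⇒quotient : ∀ k n .{{_ : NonZero k}} → ThresholdLe k n → ∃ λ Q → Q * (1000 * (k * k)) ≤ n × k ≤ 2 ^ (2 ^ suc (suc Q))
ThresholdLe⇒quotient (suc k) n threshold =
  let Q , Qd≤n , n≤ = quotient n (1000 * (suc k * suc k)) {{m*n≢0 1000 (suc k * suc k)}}
  in Q , Qd≤n , ThresholdLe⇒≤ {k} {n} {suc Q} n≤ threshold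

nonUniversal-cover : ∀ k m n Q .{{_ : NonZero k}} → 8 ≤ m → 2 ^ m ≤ k → k < 2 ^ suc m →
  Q * (1000 * (k * k)) ≤ n → k ≤ 2 ^ (2 ^ suc (suc Q)) →
  ∃ λ L → length L * 2 ^ m ≤ 4 * n ! × Covered n k L
nonUniversal-cover k@(suc k-1) m n Q 8≤m 2^m≤k k<2^1+m Qd≤n k≤ =
  grid-cover M n w k b m (suc (k / b)) (suc Q) refl refl Mw≤n (m≤[1+m/n]*n k b) line≤ (<⇒≤ k<2^1+m) m≤
  where
  open ≤-Reasoning
  k² = k * k
  -- Written so that `suc M` computes to `4 * k`.
  M = k-1 + 3 * k
  w = suc M * (2 * suc Q + 11)
  b = 8 * m

  instance
    b≢0 : NonZero b
    b≢0 = m*n≢0 8 m {{_}} {{>-nonZero (≤-trans (s≤s z≤n) 8≤m)}}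

  m≤ : m ≤ 2 ^ suc (suc Q)
  m≤ = ≮⇒≥ λ lt → <⇒≱ (^-monoʳ-< 2 (s≤s (s≤s z≤n)) lt) (≤-trans 2^m≤k k≤)

  1≤Q : 1 ≤ Q
  -- `Q ≡ 0` would give `m ≤ 4`. The bound lets the constant 208 be absorbed into `208 * Q` in
  -- `Mw≤n`.
  1≤Q = n≢0⇒n>0 λ Q≡0 → contradiction
    (≤-trans 8≤m (subst (λ q → m ≤ 2 ^ suc (suc q)) Q≡0 m≤)) (<⇒≱ (m≤m+n 5 3))

  Mw≤n : suc M * w ≤ n
  Mw≤n = begin
    4 * k * (4 * k * (2 * suc Q + 11))   ≡⟨ r₁ k Q ⟩
    (32 * Q + 208 * 1) * k²              ≤⟨ *-monoˡ-≤ k² (+-monoʳ-≤ (32 * Q) (*-monoʳ-≤ 208 1≤Q)) ⟩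
    (32 * Q + 208 * Q) * k²              ≤⟨ m≤m+n _ (760 * Q * k²) ⟩
    (32 * Q + 208 * Q) * k² + 760 * Q * k² ≡⟨ r₂ Q k² ⟩
    Q * (1000 * k²)                      ≤⟨ Qd≤n ⟩
    n                                    ∎
    where
    r₁ : ∀ k Q → 4 * k * (4 * k * (2 * suc Q + 11)) ≡ (32 * Q + 208 * 1) * (k * k)
    r₁ = solve-∀
    r₂ : ∀ Q x → (32 * Q + 208 * Q) * x + 760 * Q * x ≡ Q * (1000 * x)
    r₂ = solve-∀

  b≤k : b ≤ k
  b≤k with m≤n⇒∃[o]m+o≡n 8≤m
  ... | i , refl = ≤-trans (8*m≤2^m i) 2^m≤k

  line≤ : ∀ (j : Fin k) → line b (toℕ j) + b ≤ suc M
  line≤ j = begin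
    line b (toℕ j) + b   ≤⟨ +-mono-≤ (≤-trans (line≤2* b (toℕ j)) (*-monoʳ-≤ 2 (<⇒≤ (toℕ<n j)))) b≤k ⟩
    2 * k + k            ≤⟨ m≤m+n _ k ⟩
    2 * k + k + k        ≡⟨ r k ⟩
    4 * k                ∎
    where
    r : ∀ k → 2 * k + k + k ≡ 4 * k
    r = solve-∀

-- A positive rational has numerator at least 1, so it is at least one over its denominator.
ℕ→ℚ≤ε*ℕ→ℚ : ∀ {l N} (ε : ℚ) → 0ℚ ℚ.< ε → l * ℚ.↧ₙ ε ≤ N → ℕ→ℚ l ℚ.≤ ε ℚ.* ℕ→ℚ N
ℕ→ℚ≤ε*ℕ→ℚ {l} {N} ε@(mkℚ (ℤ.+ suc p) d-1 _) _ h = begin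
  ℕ→ℚ l                                        ≤⟨ fraction-mono-≤ l (suc p * N) 1 (suc d-1 * 1) (≤-trans (≤-reflexive (cong (l *_) (*-identityʳ (suc d-1))))
                                                    (≤-trans h (≤-trans (m≤m+n N (p * N)) (≤-reflexive (sym (*-identityʳ (suc p * N))))))) ⟩
  (ℤ.+ (suc p * N)) ℚ./ (suc d-1 * 1)            ≡⟨ fraction-* (suc p) N (suc d-1) 1 ⟨
  (ℤ.+ suc p) ℚ./ suc d-1 ℚ.* ℕ→ℚ N              ≡⟨ cong (ℚ._* ℕ→ℚ N) (ℚ.↥p/↧p≡p ε) ⟩
  ε ℚ.* ℕ→ℚ N                                  ∎
  where
  open ℚ.≤-Reasoning
ℕ→ℚ≤ε*ℕ→ℚ (mkℚ (ℤ.+ zero)   _ _) (ℚ.*<* (ℤ.+<+ ())) _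
ℕ→ℚ≤ε*ℕ→ℚ (mkℚ ℤ.-[1+ _ ] _ _) (ℚ.*<* ()) _

theorem1p2 : (ε : ℚ) → 0ℚ ℚ.< ε →
    ∃ λ K → (k : ℕ) → k ≥ K → (n : ℕ) → IsN k n →
    NonUniversalProbAtMost n k ε
theorem1p2 ε ε>0 = 2 ^ m₀ , λ k k≥K n (threshold , _) →
  let k>0 = ≤-trans (>-nonZero⁻¹ (2 ^ m₀) {{m^n≢0 2 m₀}}) k≥K
      m , 2^m≤k , k<2^1+m = binaryLog k k>0
      m₀≤m = s≤s⁻¹ (2^-cancel-< (≤-<-trans k≥K k<2^1+m))
      Q , Qd≤n , k≤ = ThresholdLe⇒quotient k n {{>-nonZero k>0}} threshold
      L , length-L , covers = nonUniversal-cover k m n Q {{>-nonZero k>0}} (≤-trans (m≤n+m 8 (4 * d)) m₀≤m) 2^m≤k k<2^1+m Qd≤n k≤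
  in L , ℕ→ℚ≤ε*ℕ→ℚ {length L} {n !} ε ε>0 (*-cancelˡ-≤ 4 (begin
       4 * (length L * d)    ≡⟨ r (length L) d ⟩
       length L * (4 * d)    ≤⟨ *-monoʳ-≤ (length L) (≤-trans (m≤m+n (4 * d) 8) (≤-trans m₀≤m (<⇒≤ (n<2^n m)))) ⟩
       length L * 2 ^ m      ≤⟨ length-L ⟩
       4 * n !               ∎)) , covers
  where
  open ≤-Reasoning
  d = ℚ.↧ₙ ε
  -- From `m₀ ≤ m`, the summand `4 * d` gives `4 * d ≤ 2 ^ m`, so the proportion `4 / 2 ^ m` is at
  -- most `1 / d`; the summand 8 gives `8 ≤ m` for `nonUniversal-cover`.
  m₀ = 4 * d + 8
  r : ∀ l d → 4 * (l * d) ≡ l * (4 * d)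
  r = solve-∀
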